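{- Let $T=\{1423,2314,2341\}$. Then $$F_T(x)=\frac{1-4x+5x^2-x^3+(1-4x+3x^2-x^3)\sqrt{1-4x}}{(1-x)(1-3x+x^2)(1-2x+\sqrt{1-4x})}.$$
   Context: $S_n(T)$ denotes the set of permutations $\pi$ of $[n]=\{1,\dots,n\}$ (one-line notation) that avoid every pattern $\tau\in T$, i.e. no subsequence of $\pi$ is order-isomorphic to $\tau$. $F_T(x)=\sum_{n\ge 0}|S_n(T)|x^n$, a formal power series, with $|S_0(T)|=1$. Here $\sqrt{1-4x}$ is the formal power series with constant term $1$ whose square is $1-4x$. -}

module Defs where

open import Agda.Builtin.FromNat using (Number; fromNat) public
open import Algebra.Properties.Monoid.Sum using (sum; sum-cong-≗; sum-init-last)
open import Data.Fin.Base using (Fin; zero; suc; toℕ; inject₁; fromℕ; opposite)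
import Data.Fin.Base as Fin
open import Data.Fin.Properties
  using (toℕ-inject₁; toℕ-fromℕ; all?; any?)
import Data.Fin.Properties as Fin
open import Data.Integer.Base using (+_)
open import Data.List.Base
  using (List; []; _∷_; length; filter; allFin; cartesianProductWith)
open import Data.List.Membership.Propositional using (_∈_)
open import Data.List.Membership.Propositional.Properties
  using (∈-allFin; ∈-cartesianProductWith⁺; ∈-filter⁺; ∈-filter⁻)
open import Data.List.Relation.Unary.All using (All)
import Data.List.Relation.Unary.All as All
open import Data.List.Relation.Unary.Any using (here)
import Data.List.Relation.Unary.AllPairs as ListAllPairs
import Data.List.Relation.Unary.Unique.Propositional as List
import Data.List.Relation.Unary.Unique.Propositional.Properties as List
open import Data.Nat.Base using (ℕ; zero; suc; _∸_; _<_)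
import Data.Nat.Literals as ℕ
import Data.Nat.Properties as ℕ
open import Data.Product.Base using (∃; _×_; _,_; proj₂)
open import Data.Rational.Base using (ℚ; 0ℚ; 1ℚ; ½; NonZero; 1/_)
import Data.Rational.Base as ℚ
import Data.Rational.Properties as ℚ
open import Data.Unit.Base using (⊤; tt) public
open import Data.Vec.Base using (Vec; []; _∷_; lookup; map)
open import Data.Vec.Functional using (Vector)
open import Data.Vec.Properties using (∷-injective)
open import Data.Vec.Relation.Unary.AllPairs using (allPairs?)
open import Data.Vec.Relation.Unary.Unique.Propositional using (Unique)
open import Function.Base using (_∘_)
open import Function.Bundles using (_⇔_; mk⇔; Equivalence)
open import Relation.Binary.PropositionalEquality
  using (_≡_; refl; sym; trans; cong; cong₂; module ≡-Reasoning)
open import Relation.Nullary using (Dec; ¬_; ¬?; map′; _×-dec_; _→-dec_)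
open import Relation.Unary using (Decidable)

instance
  numberℕ : Number ℕ
  numberℕ = ℕ.number

words : ∀ n k → List (Vec (Fin n) k)
words n zero    = [] ∷ []
words n (suc k) = cartesianProductWith _∷_ (allFin n) (words n k)

∈-words : ∀ {n k} (w : Vec (Fin n) k) → w ∈ words n k
∈-words []      = here refl
∈-words (x ∷ w) = ∈-cartesianProductWith⁺ _∷_ (∈-allFin x) (∈-words w)

words-unique : ∀ n k → List.Unique (words n k)
words-unique n zero    = All.[] ListAllPairs.∷ ListAllPairs.[]
words-unique n (suc k) =
  List.cartesianProductWith⁺ _∷_ ∷-injective (List.allFin⁺ n) (words-unique n k)

-- The one-line notation of a permutation of {1,…,n}; Fin n starts at 0.
oneLine : ∀ {n} → Vec (Fin n) n → Vec ℕ n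
oneLine = map (suc ∘ toℕ)

OrderIsomorphic : ∀ {k} → Vec ℕ k → Vec ℕ k → Set
OrderIsomorphic u v = ∀ i j → lookup u i < lookup u j ⇔ lookup v i < lookup v j

Increasing : ∀ {n k} → Vec (Fin n) k → Set
Increasing p = ∀ i j → i Fin.< j → lookup p i Fin.< lookup p j

Contains : ∀ {n k} → Vec ℕ n → Vec ℕ k → Set
Contains {n} {k} w τ =
  ∃ λ (p : Vec (Fin n) k) → Increasing p × OrderIsomorphic (map (lookup w) p) τ

-- Since π is a word of length n over n letters, having distinct letters makes
-- it a permutation.
InS : ∀ {k n} → List (Vec ℕ k) → Vec (Fin n) n → Set
InS T π = Unique π × All (λ τ → ¬ Contains (oneLine π) τ) T

anyWord? : ∀ {n k} {P : Vec (Fin n) k → Set} → Decidable P → Dec (∃ P)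
anyWord? {k = zero}  P? = map′ (λ p → [] , p) (λ { ([] , p) → p }) (P? [])
anyWord? {k = suc k} P? =
  map′ (λ { (x , w , p) → x ∷ w , p }) (λ { (x ∷ w , p) → x , w , p })
       (any? λ x → anyWord? λ w → P? (x ∷ w))

orderIsomorphic? : ∀ {k} (u v : Vec ℕ k) → Dec (OrderIsomorphic u v)
orderIsomorphic? u v = all? λ i → all? λ j →
  let a = lookup u i ℕ.<? lookup u j
      b = lookup v i ℕ.<? lookup v j
  in map′ (λ { (f , g) → mk⇔ f g })
          (λ e → Equivalence.to e , Equivalence.from e)
          ((a →-dec b) ×-dec (b →-dec a))

contains? : ∀ {n k} (w : Vec ℕ n) (τ : Vec ℕ k) → Dec (Contains w τ)
contains? w τ = anyWord? λ p →
  (all? λ i → all? λ j → (i Fin.<? j) →-dec (lookup p i Fin.<? lookup p j))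
  ×-dec orderIsomorphic? (map (lookup w) p) τ

inS? : ∀ {k n} (T : List (Vec ℕ k)) → Decidable (InS {n = n} T)
inS? T π = allPairs? (λ x y → ¬? (x Fin.≟ y)) π
           ×-dec All.all? (λ τ → ¬? (contains? (oneLine π) τ)) T

S : ∀ {k} n → List (Vec ℕ k) → List (Vec (Fin n) n)
S n T = filter (inS? T) (words n n)

∈S⇔InS : ∀ {k n} {T : List (Vec ℕ k)} {π : Vec (Fin n) n} → π ∈ S n T ⇔ InS T π
∈S⇔InS {n = n} {T} {π} = mk⇔ to from
  where
  to : π ∈ S n T → InS T π
  to π∈S = proj₂ (∈-filter⁻ {P = InS T} (inS? T) {v = π} {xs = words n n} π∈S)
  from : InS T π → π ∈ S n T
  from = ∈-filter⁺ {P = InS T} (inS? T) {x = π} {xs = words n n} (∈-words π)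

S-unique : ∀ {k} n (T : List (Vec ℕ k)) → List.Unique (S n T)
S-unique n T = List.filter⁺ (inS? T) (words-unique n n)

PowerSeries : Set
PowerSeries = ℕ → ℚ

infix  4 _≈_
infixl 6 _+_ _-_
infixl 7 _*_ _/_
infixr 8 _^_

_≈_ : PowerSeries → PowerSeries → Set
a ≈ b = ∀ n → a n ≡ b n

constant : ℚ → PowerSeries
constant c zero    = c
constant c (suc n) = 0ℚ

instance
  numberPowerSeries : Number PowerSeries
  numberPowerSeries = record
    { Constraint = λ _ → ⊤ ; fromNat = λ n → constant (+ n ℚ./ 1) }

X : PowerSeries
X zero          = 0ℚ
X (suc zero)    = 1ℚ
X (suc (suc n)) = 0ℚ

_+_ _-_ _*_ : PowerSeries → PowerSeries → PowerSeries
(a + b) n = a n ℚ.+ b n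
(a - b) n = a n ℚ.- b n
(a * b) n = sum ℚ.+-0-monoid {suc n} λ i → a (toℕ i) ℚ.* b (n ∸ toℕ i)

_^_ : PowerSeries → ℕ → PowerSeries
a ^ zero  = 1
a ^ suc n = a * a ^ n

-- Course-of-values recursion: next receives the preceding coefficients,
-- most recent first.
module _ (next : ∀ {n} → Vector ℚ n → ℚ) where

  previous : ∀ n → Vector ℚ n
  previous (suc n) zero    = next (previous n)
  previous (suc n) (suc i) = previous n i

  unfold : PowerSeries
  unfold n = next (previous n)

  previous-unfold : ∀ n i → previous n i ≡ unfold (n ∸ suc (toℕ i))
  previous-unfold (suc n) zero    = refl
  previous-unfold (suc n) (suc i) = previous-unfold n i

-- Solves b * r ≈ 1 for the coefficients of r one at a time.
nextReciprocal : (b : PowerSeries) → .{{NonZero (b 0)}} → ∀ {n} → Vector ℚ n → ℚ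
nextReciprocal b {zero}  r = 1/ b 0
nextReciprocal b {suc n} r =
  ℚ.- (1/ b 0 ℚ.* sum ℚ.+-0-monoid λ i → b (suc (toℕ i)) ℚ.* r i)

reciprocal : (b : PowerSeries) → .{{NonZero (b 0)}} → PowerSeries
reciprocal b = unfold (nextReciprocal b)

_/_ : (a b : PowerSeries) → .{{NonZero (b 0)}} → PowerSeries
a / b = a * reciprocal b

-- Solves s * s ≈ a with s 0 ≡ 1 for the coefficients of s one at a time; this
-- is meaningful only if a 0 ≡ 1.
next√ : PowerSeries → ∀ {n} → Vector ℚ n → ℚ
next√ a {zero}  s = 1ℚ
next√ a {suc n} s =
  ½ ℚ.* (a (suc n) ℚ.- sum ℚ.+-0-monoid λ i →
           s (inject₁ (opposite i)) ℚ.* s (inject₁ i))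

√ : PowerSeries → PowerSeries
√ a = unfold (next√ a)

*-reciprocal : ∀ b → .{{_ : NonZero (b 0)}} → b * reciprocal b ≈ 1
*-reciprocal b zero    = trans (ℚ.+-identityʳ _) (ℚ.*-inverseʳ (b 0))
*-reciprocal b (suc n) = begin
  b 0 ℚ.* r (suc n) ℚ.+ Σ′       ≡⟨ cong₂ ℚ._+_ head≡ (sym Σ≡Σ′) ⟩
  ℚ.- Σ ℚ.+ Σ                    ≡⟨ ℚ.+-inverseˡ Σ ⟩
  0ℚ                             ∎
  where
  open ≡-Reasoning
  r = reciprocal b
  Σ Σ′ : ℚ
  Σ  = sum ℚ.+-0-monoid {suc n} λ i → b (suc (toℕ i)) ℚ.* previous (nextReciprocal b) (suc n) i
  Σ′ = sum ℚ.+-0-monoid {suc n} λ i → b (suc (toℕ i)) ℚ.* r (n ∸ toℕ i)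
  Σ≡Σ′ : Σ ≡ Σ′
  Σ≡Σ′ = sum-cong-≗ ℚ.+-0-monoid {suc n} λ i →
    cong (b (suc (toℕ i)) ℚ.*_) (previous-unfold (nextReciprocal b) (suc n) i)
  head≡ : b 0 ℚ.* r (suc n) ≡ ℚ.- Σ
  head≡ = begin
    b 0 ℚ.* ℚ.- (1/ b 0 ℚ.* Σ)   ≡⟨ ℚ.neg-distribʳ-* (b 0) (1/ b 0 ℚ.* Σ) ⟨
    ℚ.- (b 0 ℚ.* (1/ b 0 ℚ.* Σ)) ≡⟨ cong ℚ.-_ (ℚ.*-assoc (b 0) (1/ b 0) Σ) ⟨
    ℚ.- (b 0 ℚ.* 1/ b 0 ℚ.* Σ)   ≡⟨ cong (λ z → ℚ.- (z ℚ.* Σ)) (ℚ.*-inverseʳ (b 0)) ⟩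
    ℚ.- (1ℚ ℚ.* Σ)               ≡⟨ cong ℚ.-_ (ℚ.*-identityˡ Σ) ⟩
    ℚ.- Σ                        ∎

√-constant : ∀ a → √ a 0 ≡ 1ℚ
√-constant a = refl

√-square : ∀ a → a 0 ≡ 1ℚ → √ a * √ a ≈ a
√-square a a₀≡1 zero    = sym a₀≡1
√-square a a₀≡1 (suc n) = begin
  1ℚ ℚ.* s (suc n) ℚ.+ sum ℚ.+-0-monoid f
    ≡⟨ cong (1ℚ ℚ.* s (suc n) ℚ.+_) (sum-init-last ℚ.+-0-monoid f) ⟩
  1ℚ ℚ.* s (suc n) ℚ.+ (sum ℚ.+-0-monoid (f ∘ inject₁) ℚ.+ f (fromℕ n))
    ≡⟨ cong₂ (λ y z → 1ℚ ℚ.* s (suc n) ℚ.+ (y ℚ.+ z)) (sym Σ≡Σ′) last≡ ⟩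
  1ℚ ℚ.* (½ ℚ.* (a (suc n) ℚ.- Σ)) ℚ.+ (Σ ℚ.+ ½ ℚ.* (a (suc n) ℚ.- Σ) ℚ.* 1ℚ)
    ≡⟨ halves (a (suc n)) Σ ⟩
  a (suc n) ∎
  where
  open ≡-Reasoning
  halves : ∀ x y → 1ℚ ℚ.* (½ ℚ.* (x ℚ.- y)) ℚ.+ (y ℚ.+ ½ ℚ.* (x ℚ.- y) ℚ.* 1ℚ) ≡ x
  halves x y = begin
    1ℚ ℚ.* h ℚ.+ (y ℚ.+ h ℚ.* 1ℚ)
      ≡⟨ cong₂ (λ u v → u ℚ.+ (y ℚ.+ v)) (ℚ.*-identityˡ h) (ℚ.*-identityʳ h) ⟩
    h ℚ.+ (y ℚ.+ h)
      ≡⟨ cong (h ℚ.+_) (ℚ.+-comm y h) ⟩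
    h ℚ.+ (h ℚ.+ y)          ≡⟨ ℚ.+-assoc h h y ⟨
    h ℚ.+ h ℚ.+ y            ≡⟨ cong (ℚ._+ y) (ℚ.*-distribʳ-+ (x ℚ.- y) ½ ½) ⟨
    1ℚ ℚ.* (x ℚ.- y) ℚ.+ y   ≡⟨ cong (ℚ._+ y) (ℚ.*-identityˡ (x ℚ.- y)) ⟩
    x ℚ.- y ℚ.+ y            ≡⟨ ℚ.+-assoc x (ℚ.- y) y ⟩
    x ℚ.+ (ℚ.- y ℚ.+ y)      ≡⟨ cong (x ℚ.+_) (ℚ.+-inverseˡ y) ⟩
    x ℚ.+ 0ℚ                 ≡⟨ ℚ.+-identityʳ x ⟩
    x                        ∎
    where h = ½ ℚ.* (x ℚ.- y)
  s = √ a
  f : Vector ℚ (suc n)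
  f i = s (suc (toℕ i)) ℚ.* s (n ∸ toℕ i)
  p = previous (next√ a) (suc n)
  Σ : ℚ
  Σ = sum ℚ.+-0-monoid {n} λ i → p (inject₁ (opposite i)) ℚ.* p (inject₁ i)
  index : ∀ {m} (i : Fin m) → m ∸ toℕ (opposite i) ≡ suc (toℕ i)
  index {suc m} zero    = trans (cong (suc m ∸_) (toℕ-fromℕ m)) (ℕ.m+n∸n≡m 1 m)
  index {suc m} (suc i) = begin
    suc m ∸ toℕ (inject₁ (opposite i)) ≡⟨ cong (suc m ∸_) (toℕ-inject₁ (opposite i)) ⟩
    suc m ∸ toℕ (opposite i)           ≡⟨ ℕ.+-∸-assoc 1 (Fin.toℕ≤n (opposite i)) ⟩
    suc (m ∸ toℕ (opposite i))         ≡⟨ cong suc (index i) ⟩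
    suc (suc (toℕ i))                  ∎
  Σ≡Σ′ : Σ ≡ sum ℚ.+-0-monoid (f ∘ inject₁)
  Σ≡Σ′ = sum-cong-≗ ℚ.+-0-monoid {n} λ i → cong₂ ℚ._*_
    (begin
      p (inject₁ (opposite i))             ≡⟨ previous-unfold (next√ a) (suc n) (inject₁ (opposite i)) ⟩
      s (n ∸ toℕ (inject₁ (opposite i)))   ≡⟨ cong (λ m → s (n ∸ m)) (toℕ-inject₁ (opposite i)) ⟩
      s (n ∸ toℕ (opposite i))             ≡⟨ cong s (index i) ⟩
      s (suc (toℕ i))                      ≡⟨ cong (s ∘ suc) (toℕ-inject₁ i) ⟨
      s (suc (toℕ (inject₁ i)))            ∎)
    (previous-unfold (next√ a) (suc n) (inject₁ i))
  last≡ : f (fromℕ n) ≡ s (suc n) ℚ.* 1ℚ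
  last≡ = cong₂ (λ k m → s (suc k) ℚ.* s m) (toℕ-fromℕ n)
    (trans (cong (n ∸_) (toℕ-fromℕ n)) (ℕ.n∸n≡0 n))

F : ∀ {k} → List (Vec ℕ k) → PowerSeries
F T n = + length (S n T) ℚ./ 1

{-# OPTIONS --safe #-}

-- Build permutations by prepending letters. Whether a letter a may be prepended to π depends on
-- two things only: the occurrences in π that a would complete to a forbidden pattern, and the
-- ascents of π. When b is prepended, both are updated by simple rules, so the permutations fall
-- into a generating tree whose nodes are of three types. Let c be the largest letter starting an
-- ascent, k the number of letters above c that may be prepended, and m the number of positive
-- letters up to c that may be prepended.
--   E(m,k), where 0 may not be prepended, has children E(1,k), …, E(m,k), E(0,2), …, E(0,k+1).
--   P(m,k), where 0 may be prepended, has children P(m+1,k), P(m,k) and those of E(m,k),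
--   except one of type E(m,k).
--   δ(n), the decreasing permutation of n letters, has children δ(n+1), P(0,2), …, P(0,n+1).
-- With C = 1 + x C², U = 1/(1−x) and p = (1−x)²/(1−3x+x²), the subtrees of E(m,k), P(m,k) and δ(n)
-- have generating functions UᵐCᵏ, p UᵐCᵏ and (1−p)U + p Cⁿ⁺¹; so F = (1−p)U + p C.

module Submission where

open import Algebra.Bundles using (CommutativeRing)
import Algebra.Properties.Group
import Algebra.Solver.Ring
open import Algebra.Solver.Ring.AlmostCommutativeRing
  using (_-Raw-AlmostCommutative⟶_; fromCommutativeRing)
open import Data.Bool.Base using (if_then_else_)
open import Data.Fin.Base using (Fin; zero; suc; toℕ; punchIn; punchOut)
import Data.Fin.Base as Fin
open import Data.Fin.Patterns using (0F; 1F; 2F; 3F)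
import Data.Fin.Properties as Fin
open import Data.Integer.Base as ℤ using (+_)
import Data.Integer.Properties as ℤ
open import Data.List.Base as List
  using (List; []; _∷_; length; filter; allFin; tabulate; cartesianProductWith)
open import Data.List.Membership.Propositional using () renaming (_∈_ to _∈ˡ_)
open import Data.List.Membership.Propositional.Properties
  using (∈-allFin; ∈-cartesianProductWith⁺; ∈-filter⁺; ∈-filter⁻; ∈-map⁻)
  renaming (∈-map⁺ to ∈ˡ-map⁺)
open import Data.List.Membership.Propositional.Properties.WithK using (unique∧set⇒bag)
import Data.List.Properties as List
open import Data.List.Relation.Binary.BagAndSetEquality using (∼bag⇒↭)
open import Data.List.Relation.Binary.Permutation.Propositional.Properties using (↭-length)
open import Data.List.Relation.Unary.All using ([]; _∷_)
import Data.List.Relation.Unary.AllPairs as ListAllPairs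
open import Data.List.Relation.Unary.Any using () renaming (here to hereˡ)
import Data.List.Relation.Unary.Unique.Propositional as List
import Data.List.Relation.Unary.Unique.Propositional.Properties as List
open import Data.Maybe.Base using (just; nothing)
open import Data.Nat.Base as ℕ
  using (ℕ; zero; suc; pred; _∸_; _≤_; _<_; z≤n; s≤s; z<s; s≤s⁻¹; >-nonZero)
import Data.Nat.Coprimality as ℕ
open import Data.Nat.Properties as ℕ
  using (≤-refl; ≤-reflexive; ≤-trans; ≤-antisym; <-trans; <-irrefl; <-asym; <-cmp; <-≤-trans;
         ≤-<-trans; <⇒≤; <⇒≱; <⇒≢; >⇒≢; ≰⇒>; ≮⇒≥; ≤∧≢⇒<; <⇒≤pred; <ᵇ⇒<; n≤1+n; n<1+n; m≤m+n;
         _≟_; _≤?_; _<?_; suc-pred; +-suc; +-identityʳ; m+n∸m≡n; m+[n∸m]≡n)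
open import Data.Product.Base using (∃; _×_; _,_; proj₁; proj₂)
open import Data.Rational.Base as ℚ using (ℚ; 0ℚ; 1ℚ; ½; NonZero)
import Data.Rational.Properties as ℚ
import Data.Rational.Solver as ℚ
open import Data.Sum.Base as Sum using (_⊎_; inj₁; inj₂; [_,_]′)
open import Data.Vec.Base as Vec using (Vec; []; _∷_; lookup; map)
open import Data.Vec.Membership.Propositional using (_∈_)
open import Data.Vec.Membership.Propositional.Properties using (∈-map⁺)
open import Data.Vec.Properties using (map-∘; map-cong; lookup-map)
open import Data.Vec.Relation.Unary.All as VAll using ([]; _∷_)
import Data.Vec.Relation.Unary.All.Properties as VAll
open import Data.Vec.Relation.Unary.AllPairs using ([]; _∷_)
open import Data.Vec.Relation.Unary.Any using (here; there)
open import Data.Vec.Relation.Unary.Unique.Propositional using (Unique)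
open import Function.Base using (_∘_; flip)
open import Function.Bundles using (mk⇔; Equivalence)
open import Level using (0ℓ)
open import Relation.Binary.Definitions using (WeaklyDecidable; tri<; tri≈; tri>)
open import Relation.Binary.PropositionalEquality
  using (_≡_; _≢_; refl; sym; trans; cong; cong₂; subst; module ≡-Reasoning)
import Relation.Binary.Reasoning.Setoid
open import Relation.Nullary
  using (Dec; yes; no; ¬_; ¬?; does; map′; contradiction; _×-dec_; _⊎-dec_)
open import Relation.Unary using (Decidable)
open import Defs

-- Every forbidden pattern has its second letter above its first, so a letter `b` already prepended
-- affects only letters inserted below it. Together, 2314 and 2341 ask for a pair `a < b` followed,
-- in either order, by one letter below `a` and one above `b`. Hence `b`, unless it exceeds every
-- later letter, excludes 1, ..., `b` all at once; only 0 escapes, having nothing below it. The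
-- pattern 1423 excludes `a` through `b` exactly when an ascent of the word lies between them. This
-- is why ascents are recorded, and it is the only way in which 0 can be excluded.
--
-- Once 0 is excluded it stays excluded, so nodes of type E have children of type E only. At a node
-- of type P, the least letter that ends an ascent is the next letter after 0 that may be prepended;
-- it and 0 are the only two choices that leave 0 free.
--
-- The generating functions are products because raising `m` or `k` by one gives E(m,k) one more
-- child, which one more factor U or C accounts for through U = 1 + x U or C = 1 + x C².

open Algebra.Properties.Group ℚ.+-0-group using (∙-cancelʳ)


-- Occurrences of patterns

infix 4 _⊑_

-- Inductive counterpart of the increasing position vectors in `Contains`: matching on `keep` and
-- `skip` separates the occurrences that use the first letter from those that do not, the split on
-- which prepending relies.
data _⊑_ {A : Set} : ∀ {k n} → Vec A k → Vec A n → Set where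
  []   : ∀ {n} {w : Vec A n} → [] ⊑ w
  keep : ∀ {k n x} {v : Vec A k} {w : Vec A n} → v ⊑ w → x ∷ v ⊑ x ∷ w
  skip : ∀ {k n x} {v : Vec A k} {w : Vec A n} → v ⊑ w → v ⊑ x ∷ w

Occurs : ∀ {A : Set} {k n} → (Vec A k → Set) → Vec A n → Set
Occurs P w = ∃ λ v → v ⊑ w × P v

occurs? : ∀ {A : Set} {k n} {P : Vec A k → Set} → Decidable P → (w : Vec A n) → Dec (Occurs P w)
occurs? {k = zero}  P? w       = map′ (λ p → [] , [] , p) (λ { ([] , _ , p) → p }) (P? [])
occurs? {k = suc k} P? []      = no λ { (_ , () , _) }
occurs? {k = suc k} P? (x ∷ w) = map′
  [ (λ (v , s , p) → x ∷ v , keep s , p) , (λ (v , s , p) → v , skip s , p) ]′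
  (λ { (_ , keep s , p) → inj₁ (_ , s , p) ; (_ , skip s , p) → inj₂ (_ , s , p) })
  (occurs? (λ v → P? (x ∷ v)) w ⊎-dec occurs? P? w)

⊑-map⁺ : ∀ {A B : Set} {f : A → B} {k n} {v : Vec A k} {w : Vec A n} → v ⊑ w → map f v ⊑ map f w
⊑-map⁺ []       = []
⊑-map⁺ (keep s) = keep (⊑-map⁺ s)
⊑-map⁺ (skip s) = skip (⊑-map⁺ s)

⊑-map⁻ : ∀ {A B : Set} {f : A → B} {k n} {u : Vec B k} (w : Vec A n) → u ⊑ map f w →
         ∃ λ v → u ≡ map f v × v ⊑ w
⊑-map⁻ []      []       = [] , refl , []
⊑-map⁻ (x ∷ w) []       = [] , refl , []
⊑-map⁻ (x ∷ w) (keep s) with v , refl , s′ ← ⊑-map⁻ w s = x ∷ v , refl , keep s′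
⊑-map⁻ (x ∷ w) (skip s) with v , refl , s′ ← ⊑-map⁻ w s = v , refl , skip s′

⊑-all : ∀ {A : Set} {R : A → Set} {k n} {v : Vec A k} {w : Vec A n} →
        v ⊑ w → VAll.All R w → VAll.All R v
⊑-all []       rs       = []
⊑-all (keep s) (r ∷ rs) = r ∷ ⊑-all s rs
⊑-all (skip s) (r ∷ rs) = ⊑-all s rs

∈⇒⊑ : ∀ {A : Set} {n} {w : Vec A n} {x} → x ∈ w → x ∷ [] ⊑ w
∈⇒⊑ (here refl) = keep []
∈⇒⊑ (there x∈w) = skip (∈⇒⊑ x∈w)

∈∈⇒⊑ : ∀ {A : Set} {n} {w : Vec A n} {x y} → x ∈ w → y ∈ w → x ≢ y →
       x ∷ y ∷ [] ⊑ w ⊎ y ∷ x ∷ [] ⊑ w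
∈∈⇒⊑ (here refl) (here refl) x≢y = contradiction refl x≢y
∈∈⇒⊑ (here refl) (there y∈w) x≢y = inj₁ (keep (∈⇒⊑ y∈w))
∈∈⇒⊑ (there x∈w) (here refl) x≢y = inj₂ (keep (∈⇒⊑ x∈w))
∈∈⇒⊑ (there x∈w) (there y∈w) x≢y = Sum.map skip skip (∈∈⇒⊑ x∈w y∈w x≢y)

unshift : ∀ {n k} (p : Vec (Fin (suc n)) k) → (∀ i → zero {n} Fin.< lookup p i) →
          ∃ λ q → p ≡ map suc q
unshift []          pos = [] , refl
unshift (zero  ∷ p) pos = contradiction (pos zero) λ ()
unshift (suc x ∷ p) pos with q , refl ← unshift p (pos ∘ suc) = x ∷ q , refl

increasing-unshift : ∀ {n k} (q : Vec (Fin n) k) → Increasing (map suc q) → Increasing q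
increasing-unshift q inc i j i<j
  with s≤s r ← subst (λ y → toℕ (lookup (map suc q) i) < toℕ y) (lookup-map j Fin.suc q) (inc i j i<j)
  = subst (λ x → toℕ x ≤ toℕ (lookup q j)) (lookup-map i Fin.suc q) r

increasing-shift : ∀ {n k} (q : Vec (Fin n) k) → Increasing q → Increasing (map suc q)
increasing-shift q inc i j i<j rewrite lookup-map i Fin.suc q | lookup-map j Fin.suc q = s≤s (inc i j i<j)

lookup-shift : ∀ {A : Set} {n k} x (w : Vec A n) (q : Vec (Fin n) k) →
               map (lookup (x ∷ w)) (map suc q) ≡ map (lookup w) q
lookup-shift x w q = sym (map-∘ (lookup (x ∷ w)) Fin.suc q)

⊑⇒positions : ∀ {A : Set} {k n} {v : Vec A k} {w : Vec A n} → v ⊑ w →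
              ∃ λ (p : Vec (Fin n) k) → Increasing p × map (lookup w) p ≡ v
⊑⇒positions [] = [] , (λ ()) , refl
⊑⇒positions {w = x ∷ w} (keep s) with q , inc , refl ← ⊑⇒positions s
  = zero ∷ map suc q , inc′ , cong (x ∷_) (lookup-shift x w q)
  where
  inc′ : Increasing (zero ∷ map suc q)
  inc′ zero    (suc j) _         rewrite lookup-map j Fin.suc q = z<s
  inc′ (suc i) (suc j) (s≤s i<j) = increasing-shift q inc i j i<j
⊑⇒positions {w = x ∷ w} (skip s) with q , inc , refl ← ⊑⇒positions s
  = map suc q , increasing-shift q inc , lookup-shift x w q

positions⇒⊑ : ∀ {A : Set} {k n} (w : Vec A n) (p : Vec (Fin n) k) →
              Increasing p → map (lookup w) p ⊑ w
positions⇒⊑ w       []         inc = []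
positions⇒⊑ (x ∷ w) (zero ∷ p) inc
  with q , refl ← unshift p (λ i → inc zero (suc i) z<s)
  = keep (subst (_⊑ w) (sym (lookup-shift x w q))
      (positions⇒⊑ w q (increasing-unshift q λ i j i<j → inc (suc i) (suc j) (s≤s i<j))))
positions⇒⊑ (x ∷ w) (suc a ∷ p) inc
  with q , refl ← unshift p (λ i → <-trans z<s (inc zero (suc i) z<s))
  = skip (subst (_⊑ w) (sym (lookup-shift x w (a ∷ q)))
      (positions⇒⊑ w (a ∷ q) (increasing-unshift (a ∷ q) inc)))

-- Making room for a letter, on values

punch : ℕ → ℕ → ℕ
punch zero    v       = suc v
punch (suc b) zero    = zero
punch (suc b) (suc v) = suc (punch b v)

-- The adjoint of `punch b`: `a ≤ punch b v` holds exactly when `pinch b a ≤ v`, and `punch b v < a`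
-- exactly when `v < pinch b a`. Bounds on the letters of `b ∷ w` thus become bounds on those of
-- `w`, even for `a = b`, which is not a value of `punch b`.
pinch : ℕ → ℕ → ℕ
pinch zero    a       = pred a
pinch (suc b) zero    = zero
pinch (suc b) (suc a) = suc (pinch b a)

pinch-≤ : ∀ {b a} → a ≤ b → pinch b a ≡ a
pinch-≤ {zero}  z≤n       = refl
pinch-≤ {suc b} z≤n       = refl
pinch-≤         (s≤s a≤b) = cong suc (pinch-≤ a≤b)

pinch-> : ∀ {b a} → b ≤ a → pinch b (suc a) ≡ a
pinch-> z≤n       = refl
pinch-> (s≤s b≤a) = cong suc (pinch-> b≤a)

toℕ-punchIn : ∀ {n} (b : Fin (suc n)) v → toℕ (punchIn b v) ≡ punch (toℕ b) (toℕ v)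
toℕ-punchIn zero    v       = refl
toℕ-punchIn (suc b) zero    = refl
toℕ-punchIn (suc b) (suc v) = cong suc (toℕ-punchIn b v)

≤-punch⁻ : ∀ b {a v} → a ≤ punch b v → pinch b a ≤ v
≤-punch⁻ zero    {zero}          p       = z≤n
≤-punch⁻ zero    {suc a}         (s≤s p) = p
≤-punch⁻ (suc b) {zero}          p       = z≤n
≤-punch⁻ (suc b) {suc a} {suc v} (s≤s p) = s≤s (≤-punch⁻ b p)

≤-punch⁺ : ∀ b {a v} → pinch b a ≤ v → a ≤ punch b v
≤-punch⁺ zero    {zero}          p       = z≤n
≤-punch⁺ zero    {suc a}         p       = s≤s p
≤-punch⁺ (suc b) {zero}          p       = z≤n
≤-punch⁺ (suc b) {suc a} {suc v} (s≤s p) = s≤s (≤-punch⁺ b p)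

punch-<⁻ : ∀ b {a v} → punch b v < a → v < pinch b a
punch-<⁻ zero    {suc a}         (s≤s p) = p
punch-<⁻ (suc b) {suc a} {zero}  p       = z<s
punch-<⁻ (suc b) {suc a} {suc v} (s≤s p) = s≤s (punch-<⁻ b p)

punch-<⁺ : ∀ b {a v} → v < pinch b a → punch b v < a
punch-<⁺ zero    {suc a}         p       = s≤s p
punch-<⁺ (suc b) {suc a} {zero}  p       = z<s
punch-<⁺ (suc b) {suc a} {suc v} (s≤s p) = s≤s (punch-<⁺ b p)

punch-mono-< : ∀ b {u v} → u < v → punch b u < punch b v
punch-mono-< zero                    p       = s≤s p
punch-mono-< (suc b) {zero}  {suc v} p       = z<s
punch-mono-< (suc b) {suc u} {suc v} (s≤s p) = s≤s (punch-mono-< b p)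

punch-cancel-< : ∀ b {u v} → punch b u < punch b v → u < v
punch-cancel-< zero                    (s≤s p) = p
punch-cancel-< (suc b) {zero}  {suc v} p       = z<s
punch-cancel-< (suc b) {suc u} {suc v} (s≤s p) = s≤s (punch-cancel-< b p)

<-punch⁻ : ∀ b {v} → b < punch b v → b ≤ v
<-punch⁻ zero            p       = z≤n
<-punch⁻ (suc b) {suc v} (s≤s p) = s≤s (<-punch⁻ b p)

<-punch⁺ : ∀ b {v} → b ≤ v → b < punch b v
<-punch⁺ zero            p       = z<s
<-punch⁺ (suc b) {suc v} (s≤s p) = s≤s (<-punch⁺ b p)

punch-below : ∀ b {v} → v < b → punch b v ≡ v
punch-below (suc b) {zero}  p       = refl
punch-below (suc b) {suc v} (s≤s p) = cong suc (punch-below b p)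

punch-above : ∀ b {v} → b ≤ v → punch b v ≡ suc v
punch-above zero            p       = refl
punch-above (suc b) {suc v} (s≤s p) = cong suc (punch-above b p)

≤-punch : ∀ b {v} → v ≤ punch b v
≤-punch zero            = n≤1+n _
≤-punch (suc b) {zero}  = z≤n
≤-punch (suc b) {suc v} = s≤s (≤-punch b)

-- Permutations as sequences of insertions

infixr 5 _∷_

-- A permutation is coded by prepending letters, each of which pushes up the
-- letters to its right that are at least as large.
data Code : ℕ → Set where
  []  : Code zero
  _∷_ : ∀ {n} → Fin (suc n) → Code n → Code (suc n)

decode : ∀ {n} → Code n → Vec (Fin n) n
decode []      = []
decode (b ∷ w) = b ∷ map (punchIn b) (decode w)

word : ∀ {n} → Code n → Vec ℕ n
word []      = []
word (b ∷ w) = toℕ b ∷ map (punch (toℕ b)) (word w)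

word-decode : ∀ {n} (w : Code n) → map toℕ (decode w) ≡ word w
word-decode []      = refl
word-decode (b ∷ w) = cong (toℕ b ∷_) (begin
  map toℕ (map (punchIn b) (decode w))       ≡⟨ map-∘ toℕ (punchIn b) (decode w) ⟨
  map (toℕ ∘ punchIn b) (decode w)           ≡⟨ map-cong (toℕ-punchIn b) (decode w) ⟩
  map (punch (toℕ b) ∘ toℕ) (decode w)       ≡⟨ map-∘ (punch (toℕ b)) toℕ (decode w) ⟩
  map (punch (toℕ b)) (map toℕ (decode w))   ≡⟨ cong (map (punch (toℕ b))) (word-decode w) ⟩
  map (punch (toℕ b)) (word w)               ∎)
  where open ≡-Reasoning

map-injective : ∀ {A B : Set} {f : A → B} → (∀ {x y} → f x ≡ f y → x ≡ y) →
                ∀ {n} {u v : Vec A n} → map f u ≡ map f v → u ≡ v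
map-injective inj {u = []}    {[]}    eq = refl
map-injective inj {u = x ∷ u} {y ∷ v} eq =
  cong₂ _∷_ (inj (cong Vec.head eq)) (map-injective inj (cong Vec.tail eq))

decode-injective : ∀ {n} {u v : Code n} → decode u ≡ decode v → u ≡ v
decode-injective {u = []}    {[]}    eq = refl
decode-injective {u = b ∷ u} {c ∷ v} eq with refl ← cong Vec.head eq =
  cong (b ∷_) (decode-injective
    (map-injective (Fin.punchIn-injective b _ _) (cong Vec.tail eq)))

decode-unique : ∀ {n} (w : Code n) → Unique (decode w)
decode-unique []      = []
decode-unique (b ∷ w) =
  VAll.map⁺ (VAll.universal (λ v eq → Fin.punchInᵢ≢i b v (sym eq)) (decode w)) ∷ go (decode-unique w)
  where
  go : ∀ {k} {v : Vec _ k} → Unique v → Unique (map (punchIn b) v)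
  go []       = []
  go (x ∷ xs) = VAll.map⁺ (VAll.map (λ x≢y eq → x≢y (Fin.punchIn-injective b _ _ eq)) x) ∷ go xs

punchIn-image : ∀ {n k} {b : Fin (suc n)} (v : Vec (Fin (suc n)) k) → VAll.All (b ≢_) v →
                ∃ λ u → map (punchIn b) u ≡ v
punchIn-image []      []         = [] , refl
punchIn-image (x ∷ v) (b≢x ∷ ps) with u , eq ← punchIn-image v ps =
  punchOut b≢x ∷ u , cong₂ _∷_ (Fin.punchIn-punchOut b≢x) eq

unique-map⁻ : ∀ {A B : Set} {f : A → B} {k} (v : Vec A k) → Unique (map f v) → Unique v
unique-map⁻         []      []       = []
unique-map⁻ {f = f} (x ∷ v) (p ∷ ps) =
  VAll.map (λ fx≢fy x≡y → fx≢fy (cong f x≡y)) (VAll.map⁻ p) ∷ unique-map⁻ v ps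

decode-surjective : ∀ {n} (π : Vec (Fin n) n) → Unique π → ∃ λ w → decode w ≡ π
decode-surjective []      [] = [] , refl
decode-surjective (b ∷ π) (b∉π ∷ π!)
  with ρ , refl ← punchIn-image π b∉π
  with w , refl ← decode-surjective ρ (unique-map⁻ ρ π!)
  = b ∷ w , refl

word-bounded : ∀ {n} (w : Code n) → VAll.All (_< n) (word w)
word-bounded w = subst (VAll.All (_< _)) (word-decode w) (VAll.map⁺ (VAll.universal Fin.toℕ<n (decode w)))

∈-word : ∀ {n m} (w : Code n) → m < n → m ∈ word w
∈-word {m = m} (b ∷ w) m<n with <-cmp m (toℕ b)
... | tri≈ _ refl _ = here refl
... | tri< m<b _ _  = there (subst (_∈ map (punch (toℕ b)) (word w)) (punch-below (toℕ b) m<b)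
                        (∈-map⁺ (punch (toℕ b)) (∈-word w (<-≤-trans m<b (s≤s⁻¹ (Fin.toℕ<n b))))))
∈-word {m = suc m} (b ∷ w) m<n | tri> _ _ b<m =
  there (subst (_∈ map (punch (toℕ b)) (word w)) (punch-above (toℕ b) (s≤s⁻¹ b<m))
    (∈-map⁺ (punch (toℕ b)) (∈-word w (s≤s⁻¹ m<n))))

-- Excluded letters and ascents after an insertion

Forbidden : Vec ℕ 4 → Set
Forbidden (p ∷ x ∷ y ∷ z ∷ []) =
  (p < y × y < z × z < x) ⊎ (y < p × p < x × x < z) ⊎ (z < p × p < x × x < y)

-- `Forbidden` lists 1423, 2314 and 2341 as chains of increasing values. Here the first letter `a`
-- is not inserted yet: letters that are at least `a` will be pushed above it, so `a ≤ y` replaces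
-- `a < y`.
Completes : ℕ → Vec ℕ 3 → Set
Completes a (x ∷ y ∷ z ∷ []) =
  (a ≤ y × y < z × z < x) ⊎ (y < a × a ≤ x × x < z) ⊎ (z < a × a ≤ x × x < y)

-- The bounds are those that 1423 puts on its 2 and 3, with `a` about to become the 1 and `c` the 4.
-- The two letters of an ascent need not be adjacent.
AscentIn : ℕ → ℕ → Vec ℕ 2 → Set
AscentIn a c (y ∷ z ∷ []) = a ≤ y × y < z × z < c

Dead : ∀ {n} → Code n → ℕ → Set
Dead w a = Occurs (Completes a) (word w)

Asc : ∀ {n} → Code n → ℕ → ℕ → Set
Asc w a c = Occurs (AscentIn a c) (word w)

Avoids : ∀ {n} → Code n → Set
Avoids w = ¬ Occurs Forbidden (word w)

dead? : ∀ {n} (w : Code n) → Decidable (Dead w)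
dead? w a = occurs? completes? (word w)
  where
  completes? : Decidable (Completes a)
  completes? (x ∷ y ∷ z ∷ []) =
    (a ≤? y ×-dec y <? z ×-dec z <? x) ⊎-dec (y <? a ×-dec a ≤? x ×-dec x <? z)
    ⊎-dec (z <? a ×-dec a ≤? x ×-dec x <? y)

asc-< : ∀ {n} (w : Code n) {a c} → Asc w a c → a < c
asc-< w (y ∷ z ∷ [] , _ , p , q , r) = ≤-<-trans p (<-trans q r)

module _ {n} (b : Fin (suc n)) (w : Code n) where
  private
    β = toℕ b
    v = word w

  -- An ascent of `b ∷ w` lies in `w` or starts at `b`. In the second case the best choice of its
  -- top is `b + 1`, a letter that is present exactly when `b < n`.
  asc⁻ : ∀ {a c} → Asc (b ∷ w) a c → Asc w (pinch β a) (pinch β c) ⊎ (a ≤ β × suc β < c × β < n)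
  asc⁻ (_ ∷ z′ ∷ [] , keep s , p , q , r) with z ∷ [] , refl , s′ ← ⊑-map⁻ v s
    with z<n ∷ [] ← ⊑-all s′ (word-bounded w)
    = inj₂ (p , ≤-<-trans q r , ≤-<-trans (<-punch⁻ β q) z<n)
  asc⁻ (y′ ∷ z′ ∷ [] , skip s , p , q , r) with y ∷ z ∷ [] , refl , s′ ← ⊑-map⁻ v s
    = inj₁ (y ∷ z ∷ [] , s′ , ≤-punch⁻ β p , punch-cancel-< β q , punch-<⁻ β r)

  asc⁺ : ∀ {a c} → Asc w (pinch β a) (pinch β c) ⊎ (a ≤ β × suc β < c × β < n) → Asc (b ∷ w) a c
  asc⁺ (inj₁ (y ∷ z ∷ [] , s , p , q , r)) =
    _ , skip (⊑-map⁺ s) , ≤-punch⁺ β p , punch-mono-< β q , punch-<⁺ β r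
  asc⁺ {c = c} (inj₂ (p , q , r)) =
    _ , keep (⊑-map⁺ (∈⇒⊑ (∈-word w r))) ,
    p , <-punch⁺ β ≤-refl , subst (_< c) (sym (punch-above β ≤-refl)) q

  -- If the occurrence uses `b`, then `b` is its second letter. In 1423 it is the 4, and an ascent
  -- below `b` remains. In 2314 and 2341 it is the 3, and what remains is a letter below `a` and one
  -- above `b`; this forces `0 < a` and `b < n`.
  dead⁻ : ∀ {a} → Dead (b ∷ w) a → Dead w (pinch β a) ⊎ Asc w a β ⊎ (0 < a × a ≤ β × β < n)
  dead⁻ (_ , skip s , h) with x ∷ y ∷ z ∷ [] , refl , s′ ← ⊑-map⁻ v s
    = inj₁ (_ , s′ , Sum.map
      (λ (p , q , r) → ≤-punch⁻ β p , punch-cancel-< β q , punch-cancel-< β r)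
      (Sum.map (λ (p , q , r) → punch-<⁻ β p , ≤-punch⁻ β q , punch-cancel-< β r)
               (λ (p , q , r) → punch-<⁻ β p , ≤-punch⁻ β q , punch-cancel-< β r)) h)
  dead⁻ {a} (_ , keep s , h) with y ∷ z ∷ [] , refl , s′ ← ⊑-map⁻ v s
    with ⊑-all s′ (word-bounded w) | h
  ... | _ ∷ _ ∷ [] | inj₁ (p , q , r) =
    inj₂ (inj₁ (_ , s′ , subst (a ≤_) (punch-below β (<-trans y<z z<β)) p , y<z , z<β))
    where
    y<z = punch-cancel-< β q
    z<β = ≤-<-trans (≤-punch β) r
  ... | _ ∷ z<n ∷ [] | inj₂ (inj₁ (p , q , r)) =
    inj₂ (inj₂ (≤-<-trans z≤n p , q , ≤-<-trans (<-punch⁻ β r) z<n))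
  ... | y<n ∷ _ ∷ [] | inj₂ (inj₂ (p , q , r)) =
    inj₂ (inj₂ (≤-<-trans z≤n p , q , ≤-<-trans (<-punch⁻ β r) y<n))

  dead⁺ : ∀ {a} → Dead w (pinch β a) ⊎ Asc w a β ⊎ (0 < a × a ≤ β × β < n) → Dead (b ∷ w) a
  dead⁺ (inj₁ (x ∷ y ∷ z ∷ [] , s , h)) = _ , skip (⊑-map⁺ s) , Sum.map
    (λ (p , q , r) → ≤-punch⁺ β p , punch-mono-< β q , punch-mono-< β r)
    (Sum.map (λ (p , q , r) → punch-<⁺ β p , ≤-punch⁺ β q , punch-mono-< β r)
             (λ (p , q , r) → punch-<⁺ β p , ≤-punch⁺ β q , punch-mono-< β r)) h
  dead⁺ {a} (inj₂ (inj₁ (y ∷ z ∷ [] , s , p , q , r))) = _ , keep (⊑-map⁺ s) , inj₁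
    ( subst (a ≤_) (sym (punch-below β (<-trans q r))) p
    , punch-mono-< β q
    , subst (_< β) (sym (punch-below β r)) r )
  -- The letters 0 and n − 1 of w, in whichever order they occur, complete the pattern.
  dead⁺ {a} (inj₂ (inj₂ (0<a , a≤β , β<n))) with ∈∈⇒⊑ (∈-word w 0<n) (∈-word w last<n) 0≢last
    where
    0<n    = ≤-<-trans z≤n β<n
    last<n = subst (pred n <_) (suc-pred n {{>-nonZero 0<n}}) ≤-refl
    0≢last : 0 ≢ pred n
    0≢last 0≡last = <-irrefl (trans (cong suc 0≡last) (suc-pred n {{>-nonZero 0<n}}))
                             (≤-<-trans (<-≤-trans 0<a a≤β) β<n)
  ... | inj₁ s = _ , keep (⊑-map⁺ s) , inj₂ (inj₁ (low , a≤β , high))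
    where
    low  = subst (_< a) (sym (punch-below β (<-≤-trans 0<a a≤β))) 0<a
    high = <-punch⁺ β (<⇒≤pred β<n)
  ... | inj₂ s = _ , keep (⊑-map⁺ s) , inj₂ (inj₂ (low , a≤β , high))
    where
    low  = subst (_< a) (sym (punch-below β (<-≤-trans 0<a a≤β))) 0<a
    high = <-punch⁺ β (<⇒≤pred β<n)

  avoids⁻ : Avoids (b ∷ w) → Avoids w × ¬ Dead w β
  avoids⁻ av =
    (λ { (p ∷ x ∷ y ∷ z ∷ [] , s , h) →
         av (_ , skip (⊑-map⁺ s) , Sum.map mono₃ (Sum.map mono₃ mono₃) h) }) ,
    (λ { (x ∷ y ∷ z ∷ [] , s , h) → av (_ , keep (⊑-map⁺ s) , Sum.map
      (λ (p , q , r) → <-punch⁺ β p , punch-mono-< β q , punch-mono-< β r)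
      (Sum.map (λ (p , q , r) → punch-below< p , <-punch⁺ β q , punch-mono-< β r)
               (λ (p , q , r) → punch-below< p , <-punch⁺ β q , punch-mono-< β r)) h) })
    where
    mono₃ : ∀ {x y z t u s} → x < y × z < t × u < s →
            punch β x < punch β y × punch β z < punch β t × punch β u < punch β s
    mono₃ (p , q , r) = punch-mono-< β p , punch-mono-< β q , punch-mono-< β r
    punch-below< : ∀ {y} → y < β → punch β y < β
    punch-below< y<β = subst (_< β) (sym (punch-below β y<β)) y<β

  avoids⁺ : Avoids w → ¬ Dead w β → Avoids (b ∷ w)
  avoids⁺ av alive (_ , keep s , h) with x ∷ y ∷ z ∷ [] , refl , s′ ← ⊑-map⁻ v s
    = alive (_ , s′ , Sum.map
      (λ (p , q , r) → <-punch⁻ β p , punch-cancel-< β q , punch-cancel-< β r)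
      (Sum.map (λ (p , q , r) → ≤-<-trans (≤-punch β) p , <-punch⁻ β q , punch-cancel-< β r)
               (λ (p , q , r) → ≤-<-trans (≤-punch β) p , <-punch⁻ β q , punch-cancel-< β r)) h)
  avoids⁺ av alive (_ , skip s , h) with p ∷ x ∷ y ∷ z ∷ [] , refl , s′ ← ⊑-map⁻ v s
    = av (_ , s′ , Sum.map cancel₃ (Sum.map cancel₃ cancel₃) h)
    where
    cancel₃ : ∀ {x y z t u s} → punch β x < punch β y × punch β z < punch β t × punch β u < punch β s →
              x < y × z < t × u < s
    cancel₃ (p , q , r) = punch-cancel-< β p , punch-cancel-< β q , punch-cancel-< β r

-- Permutations avoiding T and their codes

τ₁ τ₂ τ₃ : Vec ℕ 4
τ₁ = 1 ∷ 4 ∷ 2 ∷ 3 ∷ []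
τ₂ = 2 ∷ 3 ∷ 1 ∷ 4 ∷ []
τ₃ = 2 ∷ 3 ∷ 4 ∷ 1 ∷ []

T : List (Vec ℕ 4)
T = τ₁ ∷ τ₂ ∷ τ₃ ∷ []

strictMono⇒orderIsomorphic : ∀ {m k} (f : Fin m → ℕ) → (∀ {i j} → i Fin.< j → f i < f j) →
  (r : Vec (Fin m) k) → OrderIsomorphic (map f r) (map (suc ∘ toℕ) r)
strictMono⇒orderIsomorphic f mono r i j
  rewrite lookup-map i f r | lookup-map j f r
        | lookup-map i (ℕ.suc ∘ toℕ) r | lookup-map j (ℕ.suc ∘ toℕ) r
  = mk⇔ reflects (mono ∘ s≤s⁻¹)
  where
  reflects : f (lookup r i) < f (lookup r j) → suc (toℕ (lookup r i)) < suc (toℕ (lookup r j))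
  reflects fi<fj with Fin.<-cmp (lookup r i) (lookup r j)
  ... | tri< i<j _ _   = s≤s i<j
  ... | tri≈ _ i≡j _   = contradiction fi<fj (<-irrefl (cong f i≡j))
  ... | tri> _ _ j<i   = contradiction fi<fj (<-asym (mono j<i))

-- The entries of `r` are the ranks of the four letters in order of position, so a single chain of
-- values serves all three patterns.
chain⇒orderIsomorphic : ∀ {a b c d} → a < b → b < c → c < d → (r : Vec (Fin 4) 4) →
  OrderIsomorphic (map (lookup (suc a ∷ suc b ∷ suc c ∷ suc d ∷ [])) r) (map (suc ∘ toℕ) r)
chain⇒orderIsomorphic {a} {b} {c} {d} a<b b<c c<d =
  strictMono⇒orderIsomorphic _ λ {i} {j} → mono i j
  where
  mono : ∀ i j → i Fin.< j → lookup (suc a ∷ suc b ∷ suc c ∷ suc d ∷ []) i <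
                             lookup (suc a ∷ suc b ∷ suc c ∷ suc d ∷ []) j
  mono zero             (suc zero)             _ = s≤s a<b
  mono zero             (suc (suc zero))       _ = s≤s (<-trans a<b b<c)
  mono zero             (suc (suc (suc zero))) _ = s≤s (<-trans a<b (<-trans b<c c<d))
  mono (suc zero)       (suc (suc zero))       _ = s≤s b<c
  mono (suc zero)       (suc (suc (suc zero))) _ = s≤s (<-trans b<c c<d)
  mono (suc (suc zero)) (suc (suc (suc zero))) _ = s≤s c<d
  mono zero zero ()
  mono (suc zero) (suc zero) (s≤s ())
  mono (suc (suc zero)) (suc zero) (s≤s ())
  mono (suc (suc zero)) (suc (suc zero)) (s≤s (s≤s ()))
  mono (suc (suc (suc zero))) (suc zero) (s≤s ())
  mono (suc (suc (suc zero))) (suc (suc zero)) (s≤s (s≤s ()))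
  mono (suc (suc (suc zero))) (suc (suc (suc zero))) (s≤s (s≤s (s≤s ())))

oneLine-decode : ∀ {n} (w : Code n) → oneLine (decode w) ≡ map suc (word w)
oneLine-decode w = trans (map-∘ suc toℕ (decode w)) (cong (map suc) (word-decode w))

contains⁺ : ∀ {n k} (w : Code n) (τ : Vec ℕ k) →
            Occurs (λ u → OrderIsomorphic (map suc u) τ) (word w) → Contains (oneLine (decode w)) τ
contains⁺ w τ (u , s , iso)
  with p , inc , eq ← ⊑⇒positions (⊑-map⁺ {f = suc} s)
  rewrite oneLine-decode w
  = p , inc , subst (λ v → OrderIsomorphic v τ) (sym eq) iso

contains⁻ : ∀ {n k} (w : Code n) (τ : Vec ℕ k) →
            Contains (oneLine (decode w)) τ → Occurs (λ u → OrderIsomorphic (map suc u) τ) (word w)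
contains⁻ w τ (p , inc , iso) rewrite oneLine-decode w
  with u , eq , s ← ⊑-map⁻ (word w) (positions⇒⊑ (map suc (word w)) p inc)
  = u , s , subst (λ v → OrderIsomorphic v τ) eq iso

avoids⇒inS : ∀ {n} (w : Code n) → Avoids w → InS T (decode w)
avoids⇒inS w av = decode-unique w ,
  (λ c → let u , s , iso = contains⁻ w τ₁ c in av (u , s , forbidden₁ u iso)) ∷
  (λ c → let u , s , iso = contains⁻ w τ₂ c in av (u , s , forbidden₂ u iso)) ∷
  (λ c → let u , s , iso = contains⁻ w τ₃ c in av (u , s , forbidden₃ u iso)) ∷ []
  where
  lt : ∀ {k} (u τ : Vec ℕ k) → OrderIsomorphic (map suc u) τ →
       ∀ i j → lookup τ i < lookup τ j → lookup u i < lookup u j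
  lt u τ iso i j τi<τj with r ← Equivalence.from (iso i j) τi<τj
    rewrite lookup-map i ℕ.suc u | lookup-map j ℕ.suc u = s≤s⁻¹ r
  forbidden₁ : ∀ u → OrderIsomorphic (map suc u) τ₁ → Forbidden u
  forbidden₁ u@(_ ∷ _ ∷ _ ∷ _ ∷ []) iso = inj₁
    (lt u τ₁ iso 0F 2F (<ᵇ⇒< _ _ tt) , lt u τ₁ iso 2F 3F (<ᵇ⇒< _ _ tt) , lt u τ₁ iso 3F 1F (<ᵇ⇒< _ _ tt))
  forbidden₂ : ∀ u → OrderIsomorphic (map suc u) τ₂ → Forbidden u
  forbidden₂ u@(_ ∷ _ ∷ _ ∷ _ ∷ []) iso = inj₂ (inj₁
    (lt u τ₂ iso 2F 0F (<ᵇ⇒< _ _ tt) , lt u τ₂ iso 0F 1F (<ᵇ⇒< _ _ tt) , lt u τ₂ iso 1F 3F (<ᵇ⇒< _ _ tt)))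
  forbidden₃ : ∀ u → OrderIsomorphic (map suc u) τ₃ → Forbidden u
  forbidden₃ u@(_ ∷ _ ∷ _ ∷ _ ∷ []) iso = inj₂ (inj₂
    (lt u τ₃ iso 3F 0F (<ᵇ⇒< _ _ tt) , lt u τ₃ iso 0F 1F (<ᵇ⇒< _ _ tt) , lt u τ₃ iso 1F 2F (<ᵇ⇒< _ _ tt)))

inS⇒avoids : ∀ {n} (w : Code n) → InS T (decode w) → Avoids w
inS⇒avoids w (_ , av₁ ∷ av₂ ∷ av₃ ∷ []) (_ ∷ _ ∷ _ ∷ _ ∷ [] , s , inj₁ (p , q , r)) =
  av₁ (contains⁺ w τ₁ (_ , s , chain⇒orderIsomorphic p q r (0F ∷ 3F ∷ 1F ∷ 2F ∷ [])))
inS⇒avoids w (_ , av₁ ∷ av₂ ∷ av₃ ∷ []) (_ ∷ _ ∷ _ ∷ _ ∷ [] , s , inj₂ (inj₁ (p , q , r))) =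
  av₂ (contains⁺ w τ₂ (_ , s , chain⇒orderIsomorphic p q r (1F ∷ 2F ∷ 0F ∷ 3F ∷ [])))
inS⇒avoids w (_ , av₁ ∷ av₂ ∷ av₃ ∷ []) (_ ∷ _ ∷ _ ∷ _ ∷ [] , s , inj₂ (inj₂ (p , q , r))) =
  av₃ (contains⁺ w τ₃ (_ , s , chain⇒orderIsomorphic p q r (1F ∷ 2F ∷ 3F ∷ 0F ∷ [])))

avoids? : ∀ {n} → Decidable (Avoids {n})
avoids? w = ¬? (occurs? forbidden? (word w))
  where
  forbidden? : Decidable Forbidden
  forbidden? (p ∷ x ∷ y ∷ z ∷ []) =
    (p <? y ×-dec y <? z ×-dec z <? x) ⊎-dec (y <? p ×-dec p <? x ×-dec x <? z)
    ⊎-dec (z <? p ×-dec p <? x ×-dec x <? y)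

-- The tail runs in the outer loop, so that a sum over the codes of length `n + 1` splits into sums
-- over the first letter, one for each code of length `n`.
codes : ∀ n → List (Code n)
codes zero    = [] ∷ []
codes (suc n) = cartesianProductWith (flip _∷_) (codes n) (allFin (suc n))

∈-codes : ∀ {n} (w : Code n) → w ∈ˡ codes n
∈-codes []      = hereˡ refl
∈-codes (b ∷ w) = ∈-cartesianProductWith⁺ (flip _∷_) (∈-codes w) (∈-allFin b)

codes-unique : ∀ n → List.Unique (codes n)
codes-unique zero    = [] ListAllPairs.∷ ListAllPairs.[]
codes-unique (suc n) = List.cartesianProductWith⁺ (flip _∷_) (λ { refl → refl , refl })
                         (codes-unique n) (List.allFin⁺ (suc n))

-- Both lists are free of duplicates and have the same members, up to `decode`; hence each is a
-- rearrangement of the other.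
length-S : ∀ n → length (S n T) ≡ length (filter avoids? (codes n))
length-S n = trans (↭-length (∼bag⇒↭ (unique∧set⇒bag (S-unique n T) decodings-unique (mk⇔ to from))))
                   (List.length-map decode (filter avoids? (codes n)))
  where
  decodings = List.map decode (filter avoids? (codes n))
  decodings-unique : List.Unique decodings
  decodings-unique = List.map⁺ decode-injective (List.filter⁺ avoids? (codes-unique n))
  to : ∀ {π} → π ∈ˡ S n T → π ∈ˡ decodings
  to {π} π∈S = subst (_∈ˡ decodings) w≡π
    (∈ˡ-map⁺ decode (∈-filter⁺ avoids? (∈-codes w) (inS⇒avoids w (subst (InS T) (sym w≡π) inS))))
    where
    inS = Equivalence.to (∈S⇔InS {T = T}) π∈S
    w   = proj₁ (decode-surjective π (proj₁ inS))
    w≡π = proj₂ (decode-surjective π (proj₁ inS))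
  from : ∀ {π} → π ∈ˡ decodings → π ∈ˡ S n T
  from π∈ = subst (_∈ˡ S n T) (sym π≡w) (Equivalence.from (∈S⇔InS {T = T})
    (avoids⇒inS w (proj₂ (∈-filter⁻ avoids? {xs = codes n} w∈))))
    where
    w   = proj₁ (∈-map⁻ decode π∈)
    w∈  = proj₁ (proj₂ (∈-map⁻ decode π∈))
    π≡w = proj₂ (proj₂ (∈-map⁻ decode π∈))

-- Sums and counting

natural : ℕ → ℚ
natural n = + n ℚ./ 1

natural-suc : ∀ n → natural (suc n) ≡ 1ℚ ℚ.+ natural n
natural-suc n = sym (begin
  1ℚ ℚ.+ natural n
    ≡⟨ cong (1ℚ ℚ.+_) (ℚ.normalize-coprime {n} {0} (ℕ.sym (ℕ.1-coprimeTo n))) ⟩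
  (+ 1 ℤ.+ + n ℤ.* + 1) ℚ./ 1
    ≡⟨ cong (λ z → (+ 1 ℤ.+ z) ℚ./ 1) (ℤ.*-identityʳ (+ n)) ⟩
  natural (suc n) ∎)
  where
  open ≡-Reasoning

choose : ∀ {P : Set} → Dec P → ℚ → ℚ → ℚ
choose P? x y = if does P? then x else y

choose-yes : ∀ {P : Set} (P? : Dec P) {x y} → P → choose P? x y ≡ x
choose-yes (yes _) p = refl
choose-yes (no ¬p) p = contradiction p ¬p

choose-no : ∀ {P : Set} (P? : Dec P) {x y} → ¬ P → choose P? x y ≡ y
choose-no (yes p) ¬p = contradiction p ¬p
choose-no (no _)  ¬p = refl

when : ∀ {P : Set} → Dec P → ℚ → ℚ
when P? x = choose P? x 0ℚ

when-cong : ∀ {P : Set} (P? : Dec P) {x y} → (P → x ≡ y) → when P? x ≡ when P? y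
when-cong (yes p) x≡y = x≡y p
when-cong (no _)  x≡y = refl

when-cong-⇔ : ∀ {P Q : Set} (P? : Dec P) (Q? : Dec Q) {x} → (P → Q) → (Q → P) → when P? x ≡ when Q? x
when-cong-⇔ (yes p) Q? f g = sym (choose-yes Q? (f p))
when-cong-⇔ (no ¬p) Q? f g = sym (choose-no Q? (¬p ∘ g))

sumOver : ∀ {A : Set} → (A → ℚ) → List A → ℚ
sumOver f []       = 0ℚ
sumOver f (x ∷ xs) = f x ℚ.+ sumOver f xs

sumOver-cong : ∀ {A : Set} {f g : A → ℚ} → (∀ x → f x ≡ g x) → ∀ xs → sumOver f xs ≡ sumOver g xs
sumOver-cong f≡g []       = refl
sumOver-cong f≡g (x ∷ xs) = cong₂ ℚ._+_ (f≡g x) (sumOver-cong f≡g xs)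

sumOver-zero : ∀ {A : Set} {f : A → ℚ} → (∀ x → f x ≡ 0ℚ) → ∀ xs → sumOver f xs ≡ 0ℚ
sumOver-zero f≡0 []       = refl
sumOver-zero f≡0 (x ∷ xs) = cong₂ ℚ._+_ (f≡0 x) (sumOver-zero f≡0 xs)

sumOver-++ : ∀ {A : Set} (f : A → ℚ) xs ys → sumOver f (xs List.++ ys) ≡ sumOver f xs ℚ.+ sumOver f ys
sumOver-++ f []       ys = sym (ℚ.+-identityˡ _)
sumOver-++ f (x ∷ xs) ys = trans (cong (f x ℚ.+_) (sumOver-++ f xs ys)) (sym (ℚ.+-assoc (f x) _ _))

sumOver-map : ∀ {A B : Set} (f : B → ℚ) (h : A → B) xs → sumOver f (List.map h xs) ≡ sumOver (f ∘ h) xs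
sumOver-map f h []       = refl
sumOver-map f h (x ∷ xs) = cong (f (h x) ℚ.+_) (sumOver-map f h xs)

sumOver-product : ∀ {A B C : Set} (f : C → ℚ) (h : A → B → C) xs ys →
  sumOver f (cartesianProductWith h xs ys) ≡ sumOver (λ x → sumOver (λ y → f (h x y)) ys) xs
sumOver-product f h []       ys = refl
sumOver-product f h (x ∷ xs) ys =
  trans (sumOver-++ f (List.map (h x) ys) (cartesianProductWith h xs ys))
        (cong₂ ℚ._+_ (sumOver-map f (h x) ys) (sumOver-product f h xs ys))

length-filter : ∀ {A : Set} {P : A → Set} (P? : Decidable P) xs →
                natural (length (filter P? xs)) ≡ sumOver (λ x → when (P? x) 1ℚ) xs
length-filter P? []       = refl
length-filter P? (x ∷ xs) with P? x
... | yes _ = trans (natural-suc (length (filter P? xs))) (cong (1ℚ ℚ.+_) (length-filter P? xs))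
... | no _  = trans (length-filter P? xs) (sym (ℚ.+-identityˡ _))

-- Counting by extensions

Alive : ∀ {n} → Code n → ℕ → Set
Alive w a = ¬ Dead w a

alive? : ∀ {n} (w : Code n) → Decidable (Alive w)
alive? w a = ¬? (dead? w a)

-- For an avoiding `w`, the size of level `d` of the subtree below `w`; rational, to be compared
-- with coefficients of power series.
extensions : ℕ → ∀ {n} → Code n → ℚ
extensions zero    w         = 1ℚ
extensions (suc d) {n} w =
  sumOver (λ b → when (alive? w (toℕ b)) (extensions d (b ∷ w))) (allFin (suc n))

totalExtensions : ℕ → ℕ → ℚ
totalExtensions d n = sumOver (λ w → when (avoids? w) (extensions d w)) (codes n)

-- Both sides count avoiding codes of length `n + d + 1`, grouped by their tails of length `n` or of
-- length `n + 1`. Tails of avoiding codes avoid, so a code that does not avoid contributes nothing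
-- on either side.
totalExtensions-suc : ∀ d n → totalExtensions (suc d) n ≡ totalExtensions d (suc n)
totalExtensions-suc d n = sym (trans
  (sumOver-product (λ w → when (avoids? w) (extensions d w)) (flip _∷_) (codes n) (allFin (suc n)))
  (sumOver-cong (λ w → sym (perCode w (avoids? w))) (codes n)))
  where
  perCode : ∀ w (av? : Dec (Avoids w)) →
    when av? (extensions (suc d) w) ≡
    sumOver (λ b → when (avoids? (b ∷ w)) (extensions d (b ∷ w))) (allFin (suc n))
  perCode w (yes av) = sumOver-cong (λ b → when-cong-⇔ (alive? w (toℕ b)) (avoids? (b ∷ w))
    (avoids⁺ b w av) (λ av′ → proj₂ (avoids⁻ b w av′))) (allFin (suc n))
  perCode w (no ¬av) = sym (sumOver-zero (λ b → choose-no (avoids? (b ∷ w))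
    (λ av′ → ¬av (proj₁ (avoids⁻ b w av′)))) (allFin (suc n)))

totalExtensions-+ : ∀ d n → totalExtensions d n ≡ totalExtensions 0 (d ℕ.+ n)
totalExtensions-+ zero    n = refl
totalExtensions-+ (suc d) n = trans (totalExtensions-suc d n)
  (trans (totalExtensions-+ d (suc n)) (cong (totalExtensions 0) (+-suc d n)))

length-S≡extensions : ∀ n → natural (length (S n T)) ≡ extensions n []
length-S≡extensions n = begin
  natural (length (S n T))                  ≡⟨ cong natural (length-S n) ⟩
  natural (length (filter avoids? (codes n)))    ≡⟨ length-filter avoids? (codes n) ⟩
  totalExtensions 0 n                            ≡⟨ cong (totalExtensions 0) (+-identityʳ n) ⟨
  totalExtensions 0 (n ℕ.+ 0)                    ≡⟨ totalExtensions-+ n 0 ⟨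
  when (avoids? []) (extensions n []) ℚ.+ 0ℚ     ≡⟨ ℚ.+-identityʳ _ ⟩
  extensions n []                                ∎
  where
  open ≡-Reasoning

-- Sums over intervals and ranks

sumFrom : ℕ → ℕ → (ℕ → ℚ) → ℚ
sumFrom lo zero      f = 0ℚ
sumFrom lo (suc len) f = f lo ℚ.+ sumFrom (suc lo) len f

sumFrom-+ : ∀ lo len len′ f →
            sumFrom lo (len ℕ.+ len′) f ≡ sumFrom lo len f ℚ.+ sumFrom (lo ℕ.+ len) len′ f
sumFrom-+ lo zero len′ f rewrite +-identityʳ lo = sym (ℚ.+-identityˡ _)
sumFrom-+ lo (suc len) len′ f rewrite +-suc lo len =
  trans (cong (f lo ℚ.+_) (sumFrom-+ (suc lo) len len′ f)) (sym (ℚ.+-assoc (f lo) _ _))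

sumFrom-snoc : ∀ lo len f → sumFrom lo (suc len) f ≡ f (lo ℕ.+ len) ℚ.+ sumFrom lo len f
sumFrom-snoc lo zero f rewrite +-identityʳ lo = refl
sumFrom-snoc lo (suc len) f rewrite +-suc lo len = begin
  f lo ℚ.+ sumFrom (suc lo) (suc len) f             ≡⟨ cong (f lo ℚ.+_) (sumFrom-snoc (suc lo) len f) ⟩
  f lo ℚ.+ (f (suc (lo ℕ.+ len)) ℚ.+ rest)          ≡⟨ ℚ.+-assoc (f lo) _ rest ⟨
  f lo ℚ.+ f (suc (lo ℕ.+ len)) ℚ.+ rest            ≡⟨ cong (ℚ._+ rest) (ℚ.+-comm (f lo) _) ⟩
  f (suc (lo ℕ.+ len)) ℚ.+ f lo ℚ.+ rest            ≡⟨ ℚ.+-assoc (f (suc (lo ℕ.+ len))) (f lo) rest ⟩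
  f (suc (lo ℕ.+ len)) ℚ.+ (f lo ℚ.+ rest)          ∎
  where
  open ≡-Reasoning
  rest = sumFrom (suc lo) len f

sumFrom-cong : ∀ lo len {f g} → (∀ b → lo ≤ b → b < lo ℕ.+ len → f b ≡ g b) →
               sumFrom lo len f ≡ sumFrom lo len g
sumFrom-cong lo zero      f≡g = refl
sumFrom-cong lo (suc len) f≡g rewrite +-suc lo len = cong₂ ℚ._+_
  (f≡g lo ≤-refl (s≤s (m≤m+n lo len)))
  (sumFrom-cong (suc lo) len λ b lo<b → f≡g b (<⇒≤ lo<b))

-- Placing the two values at `x` crosswise states the exchange of one summand without a subtraction.
-- It serves to trade one child for another at the pivot.
sumFrom-change : ∀ lo len {f g} x → lo ≤ x → x < lo ℕ.+ len → (∀ b → lo ≤ b → b ≢ x → f b ≡ g b) →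
                 sumFrom lo len f ℚ.+ g x ≡ sumFrom lo len g ℚ.+ f x
sumFrom-change lo zero x lo≤x x<hi f≡g rewrite +-identityʳ lo = contradiction lo≤x (<⇒≱ x<hi)
sumFrom-change lo (suc len) {f} {g} x lo≤x x<hi f≡g rewrite +-suc lo len with lo ≟ x
... | yes refl = begin
  f lo ℚ.+ Φ ℚ.+ g lo     ≡⟨ cong (ℚ._+ g lo) (ℚ.+-comm (f lo) Φ) ⟩
  Φ ℚ.+ f lo ℚ.+ g lo     ≡⟨ ℚ.+-assoc Φ (f lo) (g lo) ⟩
  Φ ℚ.+ (f lo ℚ.+ g lo)   ≡⟨ ℚ.+-comm Φ _ ⟩
  f lo ℚ.+ g lo ℚ.+ Φ     ≡⟨ cong₂ ℚ._+_ (ℚ.+-comm (f lo) (g lo)) Φ≡Γ ⟩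
  g lo ℚ.+ f lo ℚ.+ Γ     ≡⟨ ℚ.+-assoc (g lo) (f lo) Γ ⟩
  g lo ℚ.+ (f lo ℚ.+ Γ)   ≡⟨ cong (g lo ℚ.+_) (ℚ.+-comm (f lo) Γ) ⟩
  g lo ℚ.+ (Γ ℚ.+ f lo)   ≡⟨ ℚ.+-assoc (g lo) Γ (f lo) ⟨
  g lo ℚ.+ Γ ℚ.+ f lo     ∎
  where
  open ≡-Reasoning
  Φ = sumFrom (suc lo) len f
  Γ = sumFrom (suc lo) len g
  Φ≡Γ : Φ ≡ Γ
  Φ≡Γ = sumFrom-cong (suc lo) len λ b lo<b _ → f≡g b (<⇒≤ lo<b) (>⇒≢ lo<b)
... | no lo≢x = begin
  f lo ℚ.+ Φ ℚ.+ g x      ≡⟨ ℚ.+-assoc (f lo) Φ (g x) ⟩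
  f lo ℚ.+ (Φ ℚ.+ g x)    ≡⟨ cong₂ ℚ._+_ (f≡g lo ≤-refl lo≢x)
                               (sumFrom-change (suc lo) len x (≤∧≢⇒< lo≤x lo≢x) x<hi
                               λ b lo<b → f≡g b (<⇒≤ lo<b)) ⟩
  g lo ℚ.+ (Γ ℚ.+ f x)    ≡⟨ ℚ.+-assoc (g lo) Γ (f x) ⟨
  g lo ℚ.+ Γ ℚ.+ f x      ∎
  where
  open ≡-Reasoning
  Φ = sumFrom (suc lo) len f
  Γ = sumFrom (suc lo) len g

sumOver-tabulate : ∀ lo n {A : Set} (h : Fin n → A) {f : A → ℚ} {g : ℕ → ℚ} →
                   (∀ i → f (h i) ≡ g (lo ℕ.+ toℕ i)) → sumOver f (tabulate h) ≡ sumFrom lo n g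
sumOver-tabulate lo zero    h         f≡g = refl
sumOver-tabulate lo (suc n) h {g = g} f≡g = cong₂ ℚ._+_
  (trans (f≡g zero) (cong g (+-identityʳ lo)))
  (sumOver-tabulate (suc lo) n (h ∘ suc) λ i → trans (f≡g (suc i)) (cong g (+-suc lo (toℕ i))))

sumBelow : ℕ → (ℕ → ℚ) → ℚ
sumBelow zero    g = 0ℚ
sumBelow (suc m) g = g m ℚ.+ sumBelow m g

count : ∀ {P : ℕ → Set} → Decidable P → ℕ → ℕ → ℕ
count P? lo zero      = 0
count P? lo (suc len) = if does (P? lo) then suc (count P? (suc lo) len) else count P? (suc lo) len

count-yes : ∀ {P : ℕ → Set} (P? : Decidable P) {lo len} → P lo →
            count P? lo (suc len) ≡ suc (count P? (suc lo) len)
count-yes P? {lo} p with P? lo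
... | yes _ = refl
... | no ¬p = contradiction p ¬p

count-none : ∀ {P : ℕ → Set} (P? : Decidable P) lo len len′ →
             (∀ a → lo ≤ a → a < lo ℕ.+ len → ¬ P a) →
             count P? lo (len ℕ.+ len′) ≡ count P? (lo ℕ.+ len) len′
count-none P? lo zero      len′ none rewrite +-identityʳ lo = refl
count-none P? lo (suc len) len′ none rewrite +-suc lo len with P? lo
... | yes p = contradiction p (none lo ≤-refl (s≤s (m≤m+n lo len)))
... | no _  = count-none P? (suc lo) len len′ λ a lo<a → none a (<⇒≤ lo<a)

count-shift : ∀ {P Q : ℕ → Set} (P? : Decidable P) (Q? : Decidable Q) lo len →
              (∀ {a} → lo ≤ a → P (suc a) → Q a) → (∀ {a} → lo ≤ a → Q a → P (suc a)) →
              count P? (suc lo) len ≡ count Q? lo len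
count-shift P? Q? lo zero      f g = refl
count-shift P? Q? lo (suc len) f g with P? (suc lo) | Q? lo
... | yes p | yes q = cong suc (count-shift P? Q? (suc lo) len (f ∘ <⇒≤) (g ∘ <⇒≤))
... | yes p | no ¬q = contradiction (f ≤-refl p) ¬q
... | no ¬p | yes q = contradiction (g ≤-refl q) ¬p
... | no ¬p | no ¬q = count-shift P? Q? (suc lo) len (f ∘ <⇒≤) (g ∘ <⇒≤)

-- The value at `b` depends only on how many letters above `b`, up to `c`, satisfy `P`. As `b` runs
-- upward through the letters satisfying `P`, this number falls by one each time and ends at 0,
-- which is the order in which `sumBelow` lists its terms.
sumFrom-rank : ∀ {P : ℕ → Set} (P? : Decidable P) (f g : ℕ → ℚ) {c} lo len → lo ℕ.+ len ≡ suc c →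
  (∀ b → b ≤ c → f b ≡ g (count P? (suc b) (c ∸ b))) →
  sumFrom lo len (λ b → when (P? b) (f b)) ≡ sumBelow (count P? lo len) g
sumFrom-rank P? f g lo zero      eq f≡g = refl
sumFrom-rank P? f g {c} lo (suc len) eq f≡g
  with refl ← ℕ.suc-injective (trans (sym (+-suc lo len)) eq)
  with P? lo | f≡g lo (m≤m+n lo len) | sumFrom-rank P? f g (suc lo) len refl f≡g
... | yes _ | eq′ | ih rewrite m+n∸m≡n lo len = cong₂ ℚ._+_ eq′ ih
... | no _  | _   | ih = trans (ℚ.+-identityˡ _) ih

sumFrom-reverse : ∀ {f g : ℕ → ℚ} lo len → (∀ b t → lo ≤ b → b ℕ.+ suc t ≡ lo ℕ.+ len → f b ≡ g t) →
                  sumFrom lo len f ≡ sumBelow len g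
sumFrom-reverse lo zero      f≡g = refl
sumFrom-reverse lo (suc len) f≡g = cong₂ ℚ._+_ (f≡g lo len ≤-refl refl)
  (sumFrom-reverse (suc lo) len λ b t lo<b eq → f≡g b t (<⇒≤ lo<b) (trans eq (sym (+-suc lo len))))

-- The generating tree

-- c is the largest letter of w that starts an ascent and m counts the positive
-- letters up to c that may be prepended to w; the k + 2 letters above c all may.
record Profile {n} (w : Code n) (c k m : ℕ) : Set where
  field
    size    : n ≡ c ℕ.+ suc (suc k)
    above   : ∀ {a} → c < a → a ≤ n → Alive w a
    ascent⁻ : ∀ {a} → Asc w a n → a ≤ c
    ascent⁺ : ∀ {a} → a ≤ c → Asc w a n
    below   : count (alive? w) 1 c ≡ m

  size′ : n ≡ suc c ℕ.+ suc k
  size′ = trans size (+-suc c (suc k))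

  1+c<n : suc c < n
  1+c<n = subst (suc c <_) (sym (trans size′ (+-suc (suc c) k))) (s≤s (m≤m+n (suc c) k))

  c<n : c < n
  c<n = <-trans (n<1+n c) 1+c<n

-- The letter 0 may be prepended, and e is the next larger letter that may be.
record Pivot {n} (w : Code n) (c e : ℕ) : Set where
  field
    alive-zero : Alive w 0
    positive   : 0 < e
    bounded    : e ≤ suc c
    alive-e    : Alive w e
    gap        : ∀ {a} → 0 < a → a < e → Dead w a
    ascent₀⁻   : ∀ {x} → Asc w 0 x → e < x
    ascent₀⁺   : ∀ {x} → e < x → Asc w 0 x

pinch≤⇒≤ : ∀ {b a c} → b ≤ c → pinch b a ≤ c → a ≤ suc c
pinch≤⇒≤ {b} {a} b≤c p with a ≤? b
... | yes a≤b = ≤-trans a≤b (≤-trans b≤c (n≤1+n _))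
pinch≤⇒≤ {b} {zero}  b≤c p | no _   = z≤n
pinch≤⇒≤ {b} {suc a} b≤c p | no a≰b = s≤s (subst (_≤ _) (pinch-> (s≤s⁻¹ (≰⇒> a≰b))) p)

pinch≤⇒≤′ : ∀ {b a c} → c < b → pinch b a ≤ c → a ≤ c
pinch≤⇒≤′ {b} {a} c<b p with a ≤? b
... | yes a≤b = subst (_≤ _) (pinch-≤ a≤b) p
pinch≤⇒≤′ {b} {zero}  c<b p | no _   = z≤n
pinch≤⇒≤′ {b} {suc a} c<b p | no a≰b =
  contradiction (subst (_≤ _) (pinch-> b≤a) p) (<⇒≱ (<-≤-trans c<b b≤a))
  where b≤a = s≤s⁻¹ (≰⇒> a≰b)

<pinch⇒< : ∀ {b e x} → b ≤ e → e < pinch b x → suc e < x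
<pinch⇒< {b} {e} {x} b≤e e<p = ≰⇒> λ x≤1+e → contradiction e<p (ℕ.≤⇒≯ (go x x≤1+e))
  where
  go : ∀ x → x ≤ suc e → pinch b x ≤ e
  go zero    _ = subst (_≤ e) (sym (pinch-≤ {b} z≤n)) z≤n
  go (suc x) p with suc x ≤? b
  ... | yes q = subst (_≤ e) (sym (pinch-≤ q)) (≤-trans q b≤e)
  ... | no ¬q = subst (_≤ e) (sym (pinch-> (s≤s⁻¹ (≰⇒> ¬q)))) (s≤s⁻¹ p)

module _ {n} (b : Fin (suc n)) (w : Code n) where
  private
    β = toℕ b

  -- A pattern that has `b` as its second letter needs its first letter below `b`, and `a + 1` is
  -- above.
  alive-above⁺ : ∀ {a} → β ≤ a → Alive w a → Alive (b ∷ w) (suc a)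
  alive-above⁺ β≤a alive d with dead⁻ b w d
  ... | inj₁ d′                  = alive (subst (Dead w) (pinch-> β≤a) d′)
  ... | inj₂ (inj₁ asc)          = <⇒≱ (asc-< w asc) (≤-trans β≤a (n≤1+n _))
  ... | inj₂ (inj₂ (_ , a<β , _)) = <⇒≱ a<β β≤a

  alive-above⁻ : ∀ {a} → β ≤ a → Alive (b ∷ w) (suc a) → Alive w a
  alive-above⁻ β≤a alive d = alive (dead⁺ b w (inj₁ (subst (Dead w) (sym (pinch-> β≤a)) d)))

  dead-below : ∀ {a} → 0 < a → a ≤ β → β < n → Dead (b ∷ w) a
  dead-below 0<a a≤β β<n = dead⁺ b w (inj₂ (inj₂ (0<a , a≤β , β<n)))

  dead-zero : Dead w 0 → Dead (b ∷ w) 0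
  dead-zero d = dead⁺ b w (inj₁ (subst (Dead w) (sym (pinch-≤ {β} z≤n)) d))

  module _ {c k m} (pr : Profile w c k m) where
    open Profile pr

    private
      below-new : ∀ t → β < n → Alive w β →
                  count (alive? (b ∷ w)) 1 (β ℕ.+ suc t) ≡ suc (count (alive? w) (suc β) t)
      below-new t β<n alive = begin
        count (alive? (b ∷ w)) 1 (β ℕ.+ suc t)
          ≡⟨ count-none (alive? (b ∷ w)) 1 β (suc t) (λ a 0<a a≤β alive′ →
               alive′ (dead-below 0<a (s≤s⁻¹ a≤β) β<n)) ⟩
        count (alive? (b ∷ w)) (suc β) (suc t)
          ≡⟨ count-yes (alive? (b ∷ w)) {len = t} (alive-above⁺ ≤-refl alive) ⟩
        suc (count (alive? (b ∷ w)) (suc (suc β)) t)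
          ≡⟨ cong suc (count-shift (alive? (b ∷ w)) (alive? w) (suc β) t
               (λ β<a → alive-above⁻ (<⇒≤ β<a)) (λ β<a → alive-above⁺ (<⇒≤ β<a))) ⟩
        suc (count (alive? w) (suc β) t) ∎
        where open ≡-Reasoning

    -- The insertion pushes `c` to `c + 1`. The letters 1, ..., β become excluded, β + 1 is free,
    -- and beyond it the old letters reappear shifted; so the new `m` is the rank of β counted from
    -- `c` downward. The ranks give the children E(1,k), ..., E(m,k).
    profile-low : β ≤ c → Alive w β →
                  Profile (b ∷ w) (suc c) k (suc (count (alive? w) (suc β) (c ∸ β)))
    profile-low β≤c alive = record
      { size    = cong suc size
      ; above   = λ { {suc a} (s≤s c<a) (s≤s a≤n) →
                      alive-above⁺ (≤-trans β≤c (<⇒≤ c<a)) (above c<a a≤n) }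
      ; ascent⁻ = λ asc → [ (λ asc′ → pinch≤⇒≤ β≤c
                                (ascent⁻ (subst (Asc w _) (pinch-> (<⇒≤ β<n)) asc′)))
                          , (λ (a≤β , _) → ≤-trans a≤β (≤-trans β≤c (n≤1+n c))) ]′ (asc⁻ b w asc)
      ; ascent⁺ = λ {a} → ascent⁺′ a
      ; below   = trans (cong (count (alive? (b ∷ w)) 1)
                          (sym (trans (+-suc β (c ∸ β)) (cong suc (m+[n∸m]≡n β≤c)))))
                        (below-new (c ∸ β) β<n alive)
      }
      where
      β<n : β < n
      β<n = ≤-<-trans β≤c c<n
      ascent⁺′ : ∀ a → a ≤ suc c → Asc (b ∷ w) a (suc n)
      ascent⁺′ a a≤1+c with a ≤? β
      ... | yes a≤β = asc⁺ b w (inj₂ (a≤β , s≤s β<n , β<n))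
      ascent⁺′ zero    _         | no 0≰β = contradiction z≤n 0≰β
      ascent⁺′ (suc a) (s≤s a≤c) | no a≰β = asc⁺ b w (inj₁
        (subst (λ z → Asc w z (pinch β (suc n))) (sym (pinch-> (s≤s⁻¹ (≰⇒> a≰β))))
          (subst (Asc w a) (sym (pinch-> (<⇒≤ β<n))) (ascent⁺ a≤c))))

    -- All earlier ascents start below β, which now starts one itself and excludes every positive
    -- letter up to β.
    profile-mid : ∀ {k′} → c < β → β < n → suc n ≡ β ℕ.+ suc (suc k′) → Profile (b ∷ w) β k′ 0
    profile-mid c<β β<n size′ = record
      { size    = size′
      ; above   = λ { {suc a} (s≤s β≤a) (s≤s a≤n) →
                      alive-above⁺ β≤a (above (<-≤-trans c<β β≤a) a≤n) }
      ; ascent⁻ = λ asc → [ (λ asc′ → ≤-trans (pinch≤⇒≤′ c<β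
                                (ascent⁻ (subst (Asc w _) (pinch-> (<⇒≤ β<n)) asc′))) (<⇒≤ c<β))
                          , proj₁ ]′ (asc⁻ b w asc)
      ; ascent⁺ = λ a≤β → asc⁺ b w (inj₂ (a≤β , s≤s β<n , β<n))
      ; below   = trans (cong (count (alive? (b ∷ w)) 1) (sym (+-identityʳ β)))
                        (count-none (alive? (b ∷ w)) 1 β 0 λ a 0<a a≤β alive′ →
                          alive′ (dead-below 0<a (s≤s⁻¹ a≤β) β<n))
      }

    -- The new maximum starts no ascent, but it can be the 4 of 1423. Since an ascent starts at `c`,
    -- it excludes every letter up to `c`; the letters above gain one.
    profile-top : β ≡ n → Profile (b ∷ w) c (suc k) 0
    profile-top β≡n = record
      { size    = trans (cong suc size) (sym (+-suc c (suc (suc k))))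
      ; above   = λ {a} → above′ a
      ; ascent⁻ = λ asc → [ (λ asc′ → pinch≤⇒≤′ c<β
                                (ascent⁻ (subst (Asc w _) (pinch-> (≤-reflexive β≡n)) asc′)))
                          , (λ (_ , _ , β<n) → contradiction β<n (<-irrefl β≡n)) ]′ (asc⁻ b w asc)
      ; ascent⁺ = λ {a} a≤c → asc⁺ b w (inj₁ (subst (λ z → Asc w z (pinch β (suc n)))
                    (sym (pinch-≤ (≤-trans a≤c (<⇒≤ c<β))))
                    (subst (Asc w a) (sym (pinch-> (≤-reflexive β≡n))) (ascent⁺ a≤c))))
      ; below   = trans (cong (count (alive? (b ∷ w)) 1) (sym (+-identityʳ c)))
                        (count-none (alive? (b ∷ w)) 1 c 0 λ a _ a≤c alive′ →
                          alive′ (dead⁺ b w (inj₂ (inj₁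
                            (subst (Asc w a) (sym β≡n) (ascent⁺ (s≤s⁻¹ a≤c)))))))
      }
      where
      c<β : c < β
      c<β = subst (c <_) (sym β≡n) c<n
      above′ : ∀ a → c < a → a ≤ suc n → Alive (b ∷ w) a
      above′ a c<a a≤1+n d with dead⁻ b w d
      ... | inj₁ d′ with a ≤? β
      ...   | yes a≤β = above c<a (subst (a ≤_) β≡n a≤β) (subst (Dead w) (pinch-≤ a≤β) d′)
      above′ (suc a) c<a a≤1+n d | inj₁ d′ | no a≰β =
        above (<-≤-trans c<β β≤a) (s≤s⁻¹ a≤1+n) (subst (Dead w) (pinch-> β≤a) d′)
        where β≤a = s≤s⁻¹ (≰⇒> a≰β)
      above′ zero () _ _ | inj₁ _ | no _
      above′ a c<a a≤1+n d | inj₂ (inj₁ asc) = <⇒≱ c<a (ascent⁻ (subst (Asc w a) β≡n asc))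
      above′ a c<a a≤1+n d | inj₂ (inj₂ (_ , _ , β<n)) = <-irrefl β≡n β<n

  module _ {c e} (pv : Pivot w c e) where
    open Pivot pv

    private
      ascent₀-pinch : ∀ {x} → Asc w (pinch β 0) (pinch β x) → e < pinch β x
      ascent₀-pinch {x} asc =
        ascent₀⁻ (subst (λ z → Asc w z (pinch β x)) (pinch-≤ {β} z≤n) asc)

    -- The letters 0 and β and an ascent below β form 1423. By the last two fields of `Pivot`, `e`
    -- is the least letter that ends an ascent, so such an ascent exists as soon as β exceeds `e`.
    dead-zero-above : e < β → Dead (b ∷ w) 0
    dead-zero-above e<β = dead⁺ b w (inj₂ (inj₁ (ascent₀⁺ e<β)))

    -- The old 0, which was free, is now 1, and it ends an ascent that starts at the new 0.
    pivot-zero : β ≡ 0 → 0 < n → Pivot (b ∷ w) (suc c) 1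
    pivot-zero β≡0 0<n = record
      { alive-zero = alive
      ; positive   = z<s
      ; bounded    = s≤s z≤n
      ; alive-e    = alive-above⁺ (≤-reflexive β≡0) alive-zero
      ; gap        = λ 0<a a<1 → contradiction (s≤s⁻¹ a<1) (<⇒≱ 0<a)
      ; ascent₀⁻   = λ asc → [ (λ asc′ → ≤-<-trans positive (<-trans (n<1+n e)
                                   (<pinch⇒< (≤-trans (≤-reflexive β≡0) z≤n) (ascent₀-pinch asc′))))
                             , (λ (_ , p , _) → subst (λ z → suc z < _) β≡0 p) ]′ (asc⁻ b w asc)
      ; ascent₀⁺   = λ 1<x → asc⁺ b w (inj₂ (z≤n , subst (λ z → suc z < _) (sym β≡0) 1<x ,
                                             subst (_< n) (sym β≡0) 0<n))
      }
      where
      alive : Alive (b ∷ w) 0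
      alive d with dead⁻ b w d
      ... | inj₁ d′                 = alive-zero (subst (Dead w) (pinch-≤ {β} z≤n) d′)
      ... | inj₂ (inj₁ asc)         = <-irrefl (sym β≡0) (asc-< w asc)
      ... | inj₂ (inj₂ (0<0 , _))   = <-irrefl refl 0<0

    -- No ascent lies below `e`, so 0 stays free. The letters 1, ..., `e` become excluded, and the
    -- old `e`, pushed to `e + 1`, is both the next free letter and the least end of an ascent.
    pivot-pivot : ∀ {c′} → β ≡ e → β < n → suc e ≤ suc c′ → Pivot (b ∷ w) c′ (suc e)
    pivot-pivot refl β<n bounded′ = record
      { alive-zero = alive
      ; positive   = z<s
      ; bounded    = bounded′
      ; alive-e    = alive-above⁺ ≤-refl alive-e
      ; gap        = λ 0<a a≤e → dead-below 0<a (s≤s⁻¹ a≤e) β<n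
      ; ascent₀⁻   = λ asc → [ (λ asc′ → <pinch⇒< ≤-refl (ascent₀-pinch asc′))
                             , (λ (_ , p , _) → p) ]′ (asc⁻ b w asc)
      ; ascent₀⁺   = λ p → asc⁺ b w (inj₂ (z≤n , p , β<n))
      }
      where
      alive : Alive (b ∷ w) 0
      alive d with dead⁻ b w d
      ... | inj₁ d′                 = alive-zero (subst (Dead w) (pinch-≤ {β} z≤n) d′)
      ... | inj₂ (inj₁ asc)         = <-irrefl refl (ascent₀⁻ asc)
      ... | inj₂ (inj₂ (0<0 , _))   = <-irrefl refl 0<0

module _ {n} {w : Code n} {c k m e} (pr : Profile w c k m) (pv : Pivot w c e) where
  open Profile pr
  open Pivot pv

  private
    1+pred-e : suc (pred e) ≡ e
    1+pred-e = ℕ.suc-pred e {{ℕ.>-nonZero positive}}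

  -- No positive letter below `e` is free, so counting from `e` upward meets all `m` of them. Hence
  -- `e` would give the child E(m,k) if 0 were excluded.
  rank-pivot : e ≤ c → suc (count (alive? w) (suc e) (c ∸ e)) ≡ m
  rank-pivot e≤c = begin
    suc (count (alive? w) (suc e) (c ∸ e))
      ≡⟨ count-yes (alive? w) {len = c ∸ e} alive-e ⟨
    count (alive? w) e (suc (c ∸ e))
      ≡⟨ cong (λ lo → count (alive? w) lo (suc (c ∸ e))) 1+pred-e ⟨
    count (alive? w) (suc (pred e)) (suc (c ∸ e))
      ≡⟨ count-none (alive? w) 1 (pred e) (suc (c ∸ e))
           (λ a 0<a a<e alive → alive (gap 0<a (subst (a <_) 1+pred-e a<e))) ⟨
    count (alive? w) 1 (pred e ℕ.+ suc (c ∸ e))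
      ≡⟨ cong (count (alive? w) 1) (trans (+-suc (pred e) (c ∸ e))
           (trans (cong (ℕ._+ (c ∸ e)) 1+pred-e) (m+[n∸m]≡n e≤c))) ⟩
    count (alive? w) 1 c
      ≡⟨ below ⟩
    m ∎
    where open ≡-Reasoning

  m≡0 : c < e → m ≡ 0
  m≡0 c<e = trans (sym below) (trans (cong (count (alive? w) 1) (sym (+-identityʳ c)))
    (count-none (alive? w) 1 c 0 λ a 0<a a≤c alive → alive (gap 0<a (<-≤-trans a≤c c<e))))

record Descending {n} (w : Code n) : Set where
  field
    alive     : ∀ {a} → a ≤ n → Alive w a
    no-ascent : ∀ {a c} → ¬ Asc w a c

module _ {n} (b : Fin (suc n)) (w : Code n) (desc : Descending w) where
  open Descending desc
  private
    β = toℕ b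

  descending-top : β ≡ n → Descending (b ∷ w)
  descending-top β≡n = record
    { alive     = λ {a} → alive′ a
    ; no-ascent = λ asc → [ no-ascent , (λ (_ , _ , β<n) → <-irrefl β≡n β<n) ]′ (asc⁻ b w asc)
    }
    where
    alive′ : ∀ a → a ≤ suc n → Alive (b ∷ w) a
    alive′ a a≤1+n d with dead⁻ b w d
    ... | inj₂ (inj₁ asc)           = no-ascent asc
    ... | inj₂ (inj₂ (_ , _ , β<n)) = <-irrefl β≡n β<n
    ... | inj₁ d′ with a ≤? β
    ...   | yes a≤β = alive (subst (a ≤_) β≡n a≤β) (subst (Dead w) (pinch-≤ a≤β) d′)
    alive′ zero    a≤1+n d | inj₁ d′ | no 0≰β = 0≰β z≤n
    alive′ (suc a) a≤1+n d | inj₁ d′ | no a≰β =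
      alive (s≤s⁻¹ a≤1+n) (subst (Dead w) (pinch-> (s≤s⁻¹ (≰⇒> a≰β))) d′)

  descending-profile : ∀ {k} → β < n → suc n ≡ β ℕ.+ suc (suc k) → Profile (b ∷ w) β k 0
  descending-profile β<n size = record
    { size    = size
    ; above   = λ { {suc a} (s≤s β≤a) (s≤s a≤n) → alive-above⁺ b w β≤a (alive a≤n) }
    ; ascent⁻ = λ asc → [ (λ asc′ → contradiction asc′ no-ascent) , proj₁ ]′ (asc⁻ b w asc)
    ; ascent⁺ = λ a≤β → asc⁺ b w (inj₂ (a≤β , s≤s β<n , β<n))
    ; below   = trans (cong (count (alive? (b ∷ w)) 1) (sym (+-identityʳ β)))
                      (count-none (alive? (b ∷ w)) 1 β 0 λ a 0<a a≤β alive′ →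
                        alive′ (dead-below b w 0<a (s≤s⁻¹ a≤β) β<n))
    }

  -- The only ascents are those that start at β, and the least letter ending one is β + 1.
  descending-pivot : β < n → Pivot (b ∷ w) β (suc β)
  descending-pivot β<n = record
    { alive-zero = λ d → [ alive z≤n ∘ subst (Dead w) (pinch-≤ {β} z≤n)
                         , [ no-ascent , (λ (0<0 , _) → <-irrefl refl 0<0) ]′ ]′ (dead⁻ b w d)
    ; positive   = z<s
    ; bounded    = ≤-refl
    ; alive-e    = alive-above⁺ b w ≤-refl (alive (<⇒≤ β<n))
    ; gap        = λ 0<a a≤β → dead-below b w 0<a (s≤s⁻¹ a≤β) β<n
    ; ascent₀⁻   = λ asc → [ (λ asc′ → contradiction asc′ no-ascent) , (λ (_ , p , _) → p) ]′ (asc⁻ b w asc)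
    ; ascent₀⁺   = λ p → asc⁺ b w (inj₂ (z≤n , p , β<n))
    }

at : ℕ → ℚ → (ℕ → ℚ) → ℕ → ℚ
at e v f b = choose (b ≟ e) v (f b)

extensions-suc : ∀ d {n} (w : Code n) {f : ℕ → ℚ} →
  (∀ b → Alive w (toℕ b) → extensions d (b ∷ w) ≡ f (toℕ b)) →
  extensions (suc d) w ≡ sumFrom 0 (suc n) (λ b → when (alive? w b) (f b))
extensions-suc d {n} w {f} eq = sumOver-tabulate 0 (suc n) (λ b → b)
  {g = λ b → when (alive? w b) (f b)} λ b → when-cong (alive? w (toℕ b)) (eq b)

-- The recurrences of the tree, with a last argument for the depth. They determine the three
-- functions by induction on depth, so the combinatorial half may assume any solution and the power
-- series half has only to exhibit one.
record Weights : Set where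
  field
    e p     : ℕ → ℕ → ℕ → ℚ
    δ       : ℕ → ℕ → ℚ
    e-zero  : ∀ m k → e m k 0 ≡ 1ℚ
    p-zero  : ∀ m k → p m k 0 ≡ 1ℚ
    δ-zero  : ∀ n → δ n 0 ≡ 1ℚ
    e-suc   : ∀ m k d → e m k (suc d) ≡
              sumBelow m (λ j → e (suc j) k d) ℚ.+ sumBelow k (λ i → e 0 (2 ℕ.+ i) d)
    -- The missing child of type E(m,k) is added on both sides.
    p-suc   : ∀ m k d → p m k (suc d) ℚ.+ e m k d ≡ p (suc m) k d ℚ.+ (p m k d ℚ.+ e m k (suc d))
    δ-suc   : ∀ n d → δ n (suc d) ≡ δ (suc n) d ℚ.+ sumBelow n (λ i → p 0 (2 ℕ.+ i) d)

module _ (weights : Weights) where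
  open Weights weights

  module _ (d : ℕ) {n} (w : Code n) {c k m} (pr : Profile w c k m) where
    open Profile pr

    -- The three branches are the children described by `profile-low`, `profile-mid` and
    -- `profile-top`.
    childWeight : ℕ → ℚ
    childWeight b = choose (b ≤? c)
      (e (suc (count (alive? w) (suc b) (c ∸ b))) (2 ℕ.+ k) d)
      (choose (b <? n) (e 0 (suc n ∸ b) d) (e 0 (3 ℕ.+ k) d))

    childWeight-low : ∀ {b} → b ≤ c →
                      childWeight b ≡ e (suc (count (alive? w) (suc b) (c ∸ b))) (2 ℕ.+ k) d
    childWeight-low {b} b≤c = choose-yes (b ≤? c) b≤c

    childWeight-mid : ∀ {b t} → c < b → b ℕ.+ suc t ≡ n → childWeight b ≡ e 0 (2 ℕ.+ t) d
    childWeight-mid {b} {t} c<b refl = begin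
      childWeight b                   ≡⟨ choose-no (b ≤? c) (<⇒≱ c<b) ⟩
      choose (b <? n) _ _             ≡⟨ choose-yes (b <? n) (subst (b <_) (sym (+-suc b t)) (s≤s (m≤m+n b t))) ⟩
      e 0 (suc (b ℕ.+ suc t) ∸ b) d   ≡⟨ cong (λ i → e 0 (i ∸ b) d) (+-suc b (suc t)) ⟨
      e 0 (b ℕ.+ (2 ℕ.+ t) ∸ b) d     ≡⟨ cong (λ i → e 0 i d) (m+n∸m≡n b (2 ℕ.+ t)) ⟩
      e 0 (2 ℕ.+ t) d                 ∎
      where open ≡-Reasoning

    childWeight-top : childWeight n ≡ e 0 (3 ℕ.+ k) d
    childWeight-top = trans (choose-no (n ≤? c) (<⇒≱ c<n))
                            (choose-no (n <? n) (<-irrefl refl))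

    sum-childWeight : sumFrom 1 n (λ b → when (alive? w b) (childWeight b)) ≡ e m (2 ℕ.+ k) (suc d)
    sum-childWeight = begin
      sumFrom 1 n f
        ≡⟨ cong (λ N → sumFrom 1 N f) size ⟩
      sumFrom 1 (c ℕ.+ suc (suc k)) f
        ≡⟨ sumFrom-+ 1 c (suc (suc k)) f ⟩
      sumFrom 1 c f ℚ.+ sumFrom (suc c) (suc (suc k)) f
        ≡⟨ cong₂ ℚ._+_ low high ⟩
      sumBelow m (λ j → e (suc j) (2 ℕ.+ k) d) ℚ.+ sumBelow (2 ℕ.+ k) (λ i → e 0 (2 ℕ.+ i) d)
        ≡⟨ e-suc m (2 ℕ.+ k) d ⟨
      e m (2 ℕ.+ k) (suc d) ∎
      where
      open ≡-Reasoning
      f : ℕ → ℚ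
      f b = when (alive? w b) (childWeight b)
      low : sumFrom 1 c f ≡ sumBelow m (λ j → e (suc j) (2 ℕ.+ k) d)
      low = trans (sumFrom-rank (alive? w) childWeight (λ j → e (suc j) (2 ℕ.+ k) d) 1 c refl
                    (λ b → childWeight-low))
                  (cong (λ m′ → sumBelow m′ (λ j → e (suc j) (2 ℕ.+ k) d)) below)
      mid : ∀ b t → c < b → b ℕ.+ suc t ≡ suc c ℕ.+ suc k → f b ≡ e 0 (2 ℕ.+ t) d
      mid b t c<b eq = trans
        (choose-yes (alive? w b) (above c<b (subst (b ≤_) b+1+t≡n (m≤m+n b (suc t)))))
        (childWeight-mid c<b b+1+t≡n)
        where
        b+1+t≡n : b ℕ.+ suc t ≡ n
        b+1+t≡n = trans eq (sym size′)
      high : sumFrom (suc c) (suc (suc k)) f ≡ sumBelow (2 ℕ.+ k) (λ i → e 0 (2 ℕ.+ i) d)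
      -- The letter `n` supplies the top term of `sumBelow`; the letters `n - 1`, `n - 2`, ..., down
      -- to `c + 1`, supply those with index 0, 1, ....
      high = trans (sumFrom-snoc (suc c) (suc k) f) (cong₂ ℚ._+_
        (begin
          f (suc c ℕ.+ suc k)  ≡⟨ cong f size′ ⟨
          f n                  ≡⟨ choose-yes (alive? w n) (above c<n ≤-refl) ⟩
          childWeight n        ≡⟨ childWeight-top ⟩
          e 0 (3 ℕ.+ k) d      ∎)
        (sumFrom-reverse (suc c) (suc k) mid))

  mutual
    -- An ascent from `c` requires `c + 1 < n`, so at least two letters lie above `c` and `Profile`
    -- counts only the others. The parameter of E is therefore `2 + k`.
    extensions-profile : ∀ d {n} (w : Code n) {c k m} → Profile w c k m → Dead w 0 →
                         extensions d w ≡ e m (2 ℕ.+ k) d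
    extensions-profile zero    w pr dead = sym (e-zero _ _)
    extensions-profile (suc d) {n} w {k = k} {m = m} pr dead = begin
      extensions (suc d) w
        ≡⟨ extensions-suc d w {f = childWeight d w pr} (λ b alive →
             extensions-child d b w pr alive (dead-zero b w dead)) ⟩
      when (alive? w 0) (childWeight d w pr 0) ℚ.+
      sumFrom 1 n (λ b → when (alive? w b) (childWeight d w pr b))
        ≡⟨ cong₂ ℚ._+_ (choose-no (alive? w 0) (λ alive → alive dead)) (sum-childWeight d w pr) ⟩
      0ℚ ℚ.+ e m (2 ℕ.+ k) (suc d)
        ≡⟨ ℚ.+-identityˡ _ ⟩
      e m (2 ℕ.+ k) (suc d) ∎
      where open ≡-Reasoning

    -- Asking for 0 to be excluded after the insertion, not before, makes this serve both kinds of
    -- parent: type E, and type P with `b` beyond the pivot.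
    extensions-child : ∀ d {n} (b : Fin (suc n)) (w : Code n) {c k m} (pr : Profile w c k m) →
                       Alive w (toℕ b) → Dead (b ∷ w) 0 →
                       extensions d (b ∷ w) ≡ childWeight d w pr (toℕ b)
    extensions-child d {n} b w {c} pr alive dead with toℕ b ≤? c
    ... | yes b≤c = trans (extensions-profile d (b ∷ w) (profile-low b w pr b≤c alive) dead)
                          (sym (childWeight-low d w pr b≤c))
    ... | no b≰c with toℕ b ≟ n
    ...   | yes b≡n = trans (extensions-profile d (b ∷ w) (profile-top b w pr b≡n) dead)
                            (trans (sym (childWeight-top d w pr)) (cong (childWeight d w pr) (sym b≡n)))
    ...   | no b≢n with t , 1+b+t≡n ← ℕ.m≤n⇒∃[o]m+o≡n (≤∧≢⇒< (s≤s⁻¹ (Fin.toℕ<n b)) b≢n)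
      with b+1+t≡n ← trans (+-suc (toℕ b) t) 1+b+t≡n =
      trans (extensions-profile d (b ∷ w)
              (profile-mid b w pr (≰⇒> b≰c) (≤∧≢⇒< (s≤s⁻¹ (Fin.toℕ<n b)) b≢n)
                (trans (cong suc (sym b+1+t≡n)) (sym (+-suc (toℕ b) (suc t))))) dead)
            (sym (childWeight-mid d w pr (≰⇒> b≰c) b+1+t≡n))

  extensions-pivot : ∀ d {n} (w : Code n) {c k m x} → Profile w c k m → Pivot w c x →
                     extensions d w ≡ p m (2 ℕ.+ k) d
  extensions-pivot zero    w pr pv = sym (p-zero _ _)
  -- With the weight of E(m,k) added, the sum over positive letters can be traded for that of an E
  -- node by exchanging the one entry at `x`; the letter 0 contributes P(m+1,k) apart.
  extensions-pivot (suc d) {n} w {c} {k} {m} {x} pr pv = ∙-cancelʳ (e m (2 ℕ.+ k) d) _ _ (begin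
    extensions (suc d) w ℚ.+ e m (2 ℕ.+ k) d
      ≡⟨ cong (ℚ._+ e m (2 ℕ.+ k) d) (extensions-suc d w {f = f} child) ⟩
    when (alive? w 0) (f 0) ℚ.+ sumFrom 1 n Φ ℚ.+ e m (2 ℕ.+ k) d
      ≡⟨ ℚ.+-assoc (when (alive? w 0) (f 0)) (sumFrom 1 n Φ) (e m (2 ℕ.+ k) d) ⟩
    when (alive? w 0) (f 0) ℚ.+ (sumFrom 1 n Φ ℚ.+ e m (2 ℕ.+ k) d)
      ≡⟨ cong₂ ℚ._+_ (choose-yes (alive? w 0) alive-zero) (begin
           sumFrom 1 n Φ ℚ.+ e m (2 ℕ.+ k) d   ≡⟨ cong (sumFrom 1 n Φ ℚ.+_) Γ-x ⟨
           sumFrom 1 n Φ ℚ.+ Γ x               ≡⟨ sumFrom-change 1 n x positive (s≤s x≤n) Φ≡Γ ⟩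
           sumFrom 1 n Γ ℚ.+ Φ x               ≡⟨ cong₂ ℚ._+_ (sum-childWeight d w pr) Φ-x ⟩
           e m (2 ℕ.+ k) (suc d) ℚ.+ p m (2 ℕ.+ k) d ≡⟨ ℚ.+-comm (e m (2 ℕ.+ k) (suc d)) _ ⟩
           p m (2 ℕ.+ k) d ℚ.+ e m (2 ℕ.+ k) (suc d) ∎) ⟩
    p (suc m) (2 ℕ.+ k) d ℚ.+ (p m (2 ℕ.+ k) d ℚ.+ e m (2 ℕ.+ k) (suc d))
      ≡⟨ p-suc m (2 ℕ.+ k) d ⟨
    p m (2 ℕ.+ k) (suc d) ℚ.+ e m (2 ℕ.+ k) d ∎)
    where
    open ≡-Reasoning
    open Profile pr
    open Pivot pv
    f Φ Γ : ℕ → ℚ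
    f = at 0 (p (suc m) (2 ℕ.+ k) d) (at x (p m (2 ℕ.+ k) d) (childWeight d w pr))
    Φ b = when (alive? w b) (f b)
    Γ b = when (alive? w b) (childWeight d w pr b)
    x<n : x < n
    x<n = ≤-<-trans bounded 1+c<n
    x≤n = <⇒≤ x<n
    x≢0 : x ≢ 0
    x≢0 = >⇒≢ positive
    Φ≡Γ : ∀ b → 1 ≤ b → b ≢ x → Φ b ≡ Γ b
    Φ≡Γ b 1≤b b≢x = when-cong (alive? w b) λ _ →
      trans (choose-no (b ≟ 0) (>⇒≢ 1≤b)) (choose-no (b ≟ x) b≢x)
    Φ-x : Φ x ≡ p m (2 ℕ.+ k) d
    Φ-x = trans (choose-yes (alive? w x) alive-e)
                (trans (choose-no (x ≟ 0) x≢0) (choose-yes (x ≟ x) refl))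
    Γ-x : Γ x ≡ e m (2 ℕ.+ k) d
    Γ-x = trans (choose-yes (alive? w x) alive-e) atPivot
      where
      atPivot : childWeight d w pr x ≡ e m (2 ℕ.+ k) d
      -- Either `x` is the lowest of the `m` free letters up to `c`, or `x = c + 1` and `m = 0`;
      -- both give E(m,k).
      atPivot with x ≤? c
      ... | yes x≤c = trans (childWeight-low d w pr x≤c)
                            (cong (λ m′ → e m′ (2 ℕ.+ k) d) (rank-pivot pr pv x≤c))
      ... | no x≰c  = trans (childWeight-mid d w pr (≰⇒> x≰c)
                              (trans (cong (ℕ._+ suc k) (≤-antisym bounded (≰⇒> x≰c))) (sym size′)))
                            (cong (λ m′ → e m′ (2 ℕ.+ k) d) (sym (m≡0 pr pv (≰⇒> x≰c))))
    child : ∀ b → Alive w (toℕ b) → extensions d (b ∷ w) ≡ f (toℕ b)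
    child zero alive = trans
      (extensions-pivot d (zero ∷ w) (profile-low zero w pr z≤n alive)
        (pivot-zero zero w pv refl (≤-<-trans z≤n x<n)))
      (cong (λ m′ → p (suc m′) (2 ℕ.+ k) d) below)
    child b@(suc b′) alive with toℕ b ≟ x
    ... | no b≢x = trans
      (extensions-child d b w pr alive (dead-zero-above b w pv x<b))
      (sym (choose-no (toℕ b ≟ x) b≢x))
      where
      x<b : x < toℕ b
      x<b = ≤∧≢⇒< (≮⇒≥ λ b<x → alive (gap z<s b<x)) (b≢x ∘ sym)
    ... | yes b≡x = trans (onPivot (toℕ b ≤? c)) (sym (choose-yes (toℕ b ≟ x) b≡x))
      where
      b<n : toℕ b < n
      b<n = subst (_< n) (sym b≡x) x<n
      onPivot : Dec (toℕ b ≤ c) → extensions d (b ∷ w) ≡ p m (2 ℕ.+ k) d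
      onPivot (yes b≤c) = trans
        (extensions-pivot d (b ∷ w) (profile-low b w pr b≤c alive)
          (pivot-pivot b w pv b≡x b<n (s≤s bounded)))
        (cong (λ m′ → p m′ (2 ℕ.+ k) d) (trans
          (cong (λ y → suc (count (alive? w) (suc y) (c ∸ y))) b≡x)
          (rank-pivot pr pv (subst (_≤ c) b≡x b≤c))))
      onPivot (no b≰c) = trans
        (extensions-pivot d (b ∷ w)
          (profile-mid b w pr (≰⇒> b≰c) b<n (trans (cong suc size) (cong (ℕ._+ suc (suc k)) 1+c≡b)))
          (pivot-pivot b w pv b≡x b<n (s≤s (≤-reflexive (sym b≡x)))))
        (cong (λ m′ → p m′ (2 ℕ.+ k) d) (sym (m≡0 pr pv (subst (c <_) b≡x (≰⇒> b≰c)))))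
        where
        1+c≡b : suc c ≡ toℕ b
        1+c≡b = ≤-antisym (≰⇒> b≰c) (≤-trans (≤-reflexive b≡x) bounded)

  extensions-descending : ∀ d {n} (w : Code n) → Descending w → extensions d w ≡ δ n d
  extensions-descending zero    w desc = sym (δ-zero _)
  extensions-descending (suc d) {n} w desc = begin
    extensions (suc d) w
      ≡⟨ extensions-suc d w {f = f} child ⟩
    sumFrom 0 (suc n) Φ
      ≡⟨ sumFrom-snoc 0 n Φ ⟩
    Φ n ℚ.+ sumFrom 0 n Φ
      ≡⟨ cong₂ ℚ._+_ (trans (choose-yes (alive? w n) (alive ≤-refl)) (choose-yes (n ≟ n) refl))
                     (sumFrom-reverse 0 n low) ⟩
    δ (suc n) d ℚ.+ sumBelow n (λ i → p 0 (2 ℕ.+ i) d)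
      ≡⟨ δ-suc n d ⟨
    δ n (suc d) ∎
    where
    open ≡-Reasoning
    open Descending desc
    f Φ : ℕ → ℚ
    f = at n (δ (suc n) d) (λ b → p 0 (suc n ∸ b) d)
    Φ b = when (alive? w b) (f b)
    low : ∀ b t → 0 ≤ b → b ℕ.+ suc t ≡ n → Φ b ≡ p 0 (2 ℕ.+ t) d
    low b t _ b+1+t≡n = trans (choose-yes (alive? w b) (alive (<⇒≤ b<n))) (trans
      (choose-no (b ≟ n) (<⇒≢ b<n))
      (cong (λ i → p 0 i d) (trans (cong (λ N → suc N ∸ b) (sym b+1+t≡n))
        (trans (cong (_∸ b) (sym (+-suc b (suc t)))) (m+n∸m≡n b (2 ℕ.+ t))))))
      where
      b<n : b < n
      b<n = subst (b <_) (trans (sym (+-suc b t)) b+1+t≡n) (s≤s (m≤m+n b t))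
    child : ∀ b → Alive w (toℕ b) → extensions d (b ∷ w) ≡ f (toℕ b)
    child b _ with toℕ b ≟ n
    ... | yes b≡n = trans (extensions-descending d (b ∷ w) (descending-top b w desc b≡n))
                          (sym (choose-yes (toℕ b ≟ n) b≡n))
    ... | no b≢n with b<n ← ≤∧≢⇒< (s≤s⁻¹ (Fin.toℕ<n b)) b≢n
      with t , 1+b+t≡n ← ℕ.m≤n⇒∃[o]m+o≡n b<n =
      trans (extensions-pivot d (b ∷ w)
              (descending-profile b w desc b<n 1+n≡b+2+t)
              (descending-pivot b w desc b<n))
      (trans (cong (λ i → p 0 i d) (sym (trans (cong (_∸ toℕ b) 1+n≡b+2+t) (m+n∸m≡n (toℕ b) (2 ℕ.+ t)))))
             (sym (choose-no (toℕ b ≟ n) b≢n)))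
      where
      1+n≡b+2+t : suc n ≡ toℕ b ℕ.+ (2 ℕ.+ t)
      1+n≡b+2+t = trans (cong suc (trans (sym 1+b+t≡n) (sym (+-suc (toℕ b) t))))
                        (sym (+-suc (toℕ b) (suc t)))

-- The ring of power series

-- The overloaded literals of Defs block the evaluation of the solvers' types.
one two three four five : ℕ
one   = 1
two   = 2
three = 3
four  = 4
five  = 5

module _ where
  open ℚ.+-*-Solver using (solve; _:=_; _:+_; _:*_; _:-_; con)

  tail : PowerSeries → PowerSeries
  tail a n = a (suc n)

  0# : PowerSeries
  0# = constant 0ℚ

  -- Splitting off the first coefficient of the left factor holds by computation. This is the mirror
  -- image, from which commutativity follows by induction.
  *-suc-coefficientʳ : ∀ a b n → (a * b) (suc n) ≡ (a * tail b) n ℚ.+ a (suc n) ℚ.* b 0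
  *-suc-coefficientʳ a b zero    =
    solve two (λ x y → x :+ (y :+ con 0ℚ) := x :+ con 0ℚ :+ y) refl (a 0 ℚ.* b 1) (a 1 ℚ.* b 0)
  *-suc-coefficientʳ a b (suc n) =
    trans (cong (a 0 ℚ.* b (suc (suc n)) ℚ.+_) (*-suc-coefficientʳ (tail a) b n))
          (sym (ℚ.+-assoc (a 0 ℚ.* b (suc (suc n))) _ _))

  *-cong : ∀ {a b c d} → a ≈ b → c ≈ d → a * c ≈ b * d
  *-cong a≈b c≈d zero    = cong (ℚ._+ 0ℚ) (cong₂ ℚ._*_ (a≈b 0) (c≈d 0))
  *-cong a≈b c≈d (suc n) = cong₂ ℚ._+_ (cong₂ ℚ._*_ (a≈b 0) (c≈d (suc n)))
                                       (*-cong (a≈b ∘ suc) c≈d n)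

  *-comm : ∀ a b → a * b ≈ b * a
  *-comm a b zero    = cong (ℚ._+ 0ℚ) (ℚ.*-comm (a 0) (b 0))
  *-comm a b (suc n) = begin
    a 0 ℚ.* b (suc n) ℚ.+ (tail a * b) n   ≡⟨ cong₂ ℚ._+_ (ℚ.*-comm (a 0) (b (suc n))) (*-comm (tail a) b n) ⟩
    b (suc n) ℚ.* a 0 ℚ.+ (b * tail a) n   ≡⟨ ℚ.+-comm (b (suc n) ℚ.* a 0) _ ⟩
    (b * tail a) n ℚ.+ b (suc n) ℚ.* a 0   ≡⟨ *-suc-coefficientʳ b a n ⟨
    (b * a) (suc n)                        ∎
    where open ≡-Reasoning

  *-distribʳ : ∀ c a b → (a + b) * c ≈ a * c + b * c
  *-distribʳ c a b zero    =
    solve three (λ x y z → (y :+ z) :* x :+ con 0ℚ := y :* x :+ con 0ℚ :+ (z :* x :+ con 0ℚ)) refl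
      (c 0) (a 0) (b 0)
  *-distribʳ c a b (suc n) = trans
    (cong ((a 0 ℚ.+ b 0) ℚ.* c (suc n) ℚ.+_) (*-distribʳ c (tail a) (tail b) n))
    (solve five (λ x y z u v → (y :+ z) :* x :+ (u :+ v) := y :* x :+ u :+ (z :* x :+ v)) refl
      (c (suc n)) (a 0) (b 0) ((tail a * c) n) ((tail b * c) n))

  scale-* : ∀ k a b → (λ i → k ℚ.* a i) * b ≈ λ n → k ℚ.* (a * b) n
  scale-* k a b zero    =
    solve three (λ x y z → x :* y :* z :+ con 0ℚ := x :* (y :* z :+ con 0ℚ)) refl k (a 0) (b 0)
  scale-* k a b (suc n) = trans (cong (k ℚ.* a 0 ℚ.* b (suc n) ℚ.+_) (scale-* k (tail a) b n))
    (solve four (λ x y z u → x :* y :* z :+ x :* u := x :* (y :* z :+ u)) refl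
      k (a 0) (b (suc n)) ((tail a * b) n))

  *-assoc : ∀ a b c → a * b * c ≈ a * (b * c)
  *-assoc a b c zero    = solve three
    (λ x y z → (x :* y :+ con 0ℚ) :* z :+ con 0ℚ := x :* (y :* z :+ con 0ℚ) :+ con 0ℚ) refl
    (a 0) (b 0) (c 0)
  *-assoc a b c (suc n) = begin
    (a * b) 0 ℚ.* c (suc n) ℚ.+ (tail (a * b) * c) n
      ≡⟨ cong ((a * b) 0 ℚ.* c (suc n) ℚ.+_) (*-distribʳ c (λ i → a 0 ℚ.* tail b i) (tail a * b) n) ⟩
    (a * b) 0 ℚ.* c (suc n) ℚ.+ (((λ i → a 0 ℚ.* tail b i) * c) n ℚ.+ (tail a * b * c) n)
      ≡⟨ cong ((a * b) 0 ℚ.* c (suc n) ℚ.+_)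
           (cong₂ ℚ._+_ (scale-* (a 0) (tail b) c n) (*-assoc (tail a) b c n)) ⟩
    (a * b) 0 ℚ.* c (suc n) ℚ.+ (a 0 ℚ.* (tail b * c) n ℚ.+ (tail a * (b * c)) n)
      ≡⟨ solve five (λ x y z u v → (x :* y :+ con 0ℚ) :* z :+ (x :* u :+ v) := x :* (y :* z :+ u) :+ v) refl
           (a 0) (b 0) (c (suc n)) ((tail b * c) n) ((tail a * (b * c)) n) ⟩
    a 0 ℚ.* (b * c) (suc n) ℚ.+ (tail a * (b * c)) n ∎
    where open ≡-Reasoning

  zero-* : ∀ a → (λ _ → 0ℚ) * a ≈ λ _ → 0ℚ
  zero-* a zero    = trans (ℚ.+-identityʳ _) (ℚ.*-zeroˡ (a 0))
  zero-* a (suc n) = cong₂ ℚ._+_ (ℚ.*-zeroˡ (a (suc n))) (zero-* a n)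

  constant-* : ∀ k a n → (constant k * a) n ≡ k ℚ.* a n
  constant-* k a zero    = ℚ.+-identityʳ _
  constant-* k a (suc n) = trans (cong (k ℚ.* a (suc n) ℚ.+_) (zero-* a n)) (ℚ.+-identityʳ _)

  *-identityˡ : ∀ a → 1 * a ≈ a
  *-identityˡ a n = trans (constant-* 1ℚ a n) (ℚ.*-identityˡ (a n))

  X*-suc : ∀ a n → (X * a) (suc n) ≡ a n
  X*-suc a n = trans (trans (cong₂ ℚ._+_ (ℚ.*-zeroˡ (a (suc n))) refl) (ℚ.+-identityˡ _))
                     (trans (*-cong {c = a} tail-X (λ _ → refl) n) (*-identityˡ a n))
    where
    tail-X : tail X ≈ 1
    tail-X zero    = refl
    tail-X (suc n) = refl

  X*-zero : ∀ a → (X * a) 0 ≡ 0ℚ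
  X*-zero a = trans (ℚ.+-identityʳ _) (ℚ.*-zeroˡ (a 0))

  negated-half : ∀ x → 0ℚ ℚ.- (+ 2 ℚ./ 1) ℚ.* (ℚ.- ½ ℚ.* x) ≡ x
  negated-half = solve one (λ x → con 0ℚ :- con (+ 2 ℚ./ 1) :* (con (ℚ.- ½) :* x) := x) refl

  rearrange : ∀ y z s t → y ℚ.+ z ℚ.+ s ℚ.+ t ≡ y ℚ.+ t ℚ.+ (z ℚ.+ s)
  rearrange = solve four (λ y z s t → y :+ z :+ s :+ t := y :+ t :+ (z :+ s)) refl

powerSeriesRing : CommutativeRing 0ℓ 0ℓ
powerSeriesRing = record
  { Carrier = PowerSeries
  ; _≈_ = _≈_
  ; _+_ = _+_
  ; _*_ = _*_
  ; -_ = λ a n → ℚ.- a n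
  ; 0# = 0#
  ; 1# = 1
  ; isCommutativeRing = record
    { isRing = record
      { +-isAbelianGroup = record
        { isGroup = record
          { isMonoid = record
            { isSemigroup = record
              { isMagma = record
                { isEquivalence = record
                  { refl = λ _ → refl ; sym = λ p n → sym (p n) ; trans = λ p q n → trans (p n) (q n) }
                ; ∙-cong = λ p q n → cong₂ ℚ._+_ (p n) (q n) }
              ; assoc = λ a b c n → ℚ.+-assoc (a n) (b n) (c n) }
            ; identity = (λ a n → trans (cong (ℚ._+ a n) (0#-coefficient n)) (ℚ.+-identityˡ (a n)))
                       , (λ a n → trans (cong (a n ℚ.+_) (0#-coefficient n)) (ℚ.+-identityʳ (a n))) }
          ; inverse = (λ a n → trans (ℚ.+-inverseˡ (a n)) (sym (0#-coefficient n)))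
                    , (λ a n → trans (ℚ.+-inverseʳ (a n)) (sym (0#-coefficient n)))
          ; ⁻¹-cong = λ p n → cong ℚ.-_ (p n) }
        ; comm = λ a b n → ℚ.+-comm (a n) (b n) }
      ; *-cong = *-cong
      ; *-assoc = *-assoc
      ; *-identity = *-identityˡ , (λ a n → trans (*-comm a 1 n) (*-identityˡ a n))
      ; distrib = (λ c a b n → trans (*-comm c (a + b) n) (trans (*-distribʳ c a b n)
                    (cong₂ ℚ._+_ (*-comm a c n) (*-comm b c n))))
                , *-distribʳ }
    ; *-comm = *-comm } }
  where
  0#-coefficient : ∀ n → 0# n ≡ 0ℚ
  0#-coefficient zero    = refl
  0#-coefficient (suc n) = refl

constant-homomorphism : ℚ.+-*-rawRing -Raw-AlmostCommutative⟶ fromCommutativeRing powerSeriesRing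
constant-homomorphism = record
  { ⟦_⟧    = constant
  ; +-homo = λ { x y zero → refl ; x y (suc n) → refl }
  ; *-homo = λ { x y zero → sym (ℚ.+-identityʳ _)
               ; x y (suc n) → sym (trans (constant-* x (constant y) (suc n)) (ℚ.*-zeroʳ x)) }
  ; -‿homo = λ { x zero → refl ; x (suc n) → refl }
  ; 0-homo = λ _ → refl
  ; 1-homo = λ _ → refl
  }

constant-≟ : WeaklyDecidable λ x y → constant x ≈ constant y
constant-≟ x y with x ℚ.≟ y
... | yes refl = just λ _ → refl
... | no _     = nothing

module SeriesSolver =
  Algebra.Solver.Ring ℚ.+-*-rawRing (fromCommutativeRing powerSeriesRing)
    constant-homomorphism constant-≟

module R = CommutativeRing powerSeriesRing
open SeriesSolver using (_:=_; con; _:+_; _:*_; _:-_; _:^_) renaming (solve to solveSeries)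

-- Generating functions

√1-4X : PowerSeries
√1-4X = √ (1 - 4 * X)

-- (1 − √(1−4x)) / 2x, the generating function of the Catalan numbers.
catalan : PowerSeries
catalan n = ℚ.- ½ ℚ.* √1-4X (suc n)

√≈catalan : √1-4X ≈ 1 - 2 * (X * catalan)
√≈catalan zero    = sym (cong (λ z → 1ℚ ℚ.- z)
  (trans (constant-* (+ 2 ℚ./ 1) (X * catalan) 0) (cong ((+ 2 ℚ./ 1) ℚ.*_) (X*-zero catalan))))
√≈catalan (suc n) = sym (begin
  0ℚ ℚ.- (2 * (X * catalan)) (suc n)
    ≡⟨ cong (λ z → 0ℚ ℚ.- z) (trans (constant-* (+ 2 ℚ./ 1) (X * catalan) (suc n))
         (cong ((+ 2 ℚ./ 1) ℚ.*_) (X*-suc catalan n))) ⟩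
  0ℚ ℚ.- (+ 2 ℚ./ 1) ℚ.* (ℚ.- ½ ℚ.* √1-4X (suc n))
    ≡⟨ negated-half (√1-4X (suc n)) ⟩
  √1-4X (suc n) ∎)
  where open ≡-Reasoning

-- Squaring √(1-4x) = 1 - 2xC shows that `X * (4 * defect)` is zero. Reading it one coefficient
-- later cancels `X`, and the factor 1/4 cancels the 4.
catalan-equation : catalan ≈ 1 + X * (catalan * catalan)
catalan-equation = R.sym (begin
  1 + X * (catalan * catalan)
    ≈⟨ solveSeries two (λ a b → a := b :- con (+ 1 ℚ./ 4) :* (con (+ 4 ℚ./ 1) :* (b :- a))) R.refl
         (1 + X * (catalan * catalan)) catalan ⟩
  catalan - constant (+ 1 ℚ./ 4) * (4 * defect)
    ≈⟨ R.+-congˡ {catalan} (R.-‿cong (R.*-congˡ {constant (+ 1 ℚ./ 4)} 4defect≈0)) ⟩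
  catalan - constant (+ 1 ℚ./ 4) * 0
    ≈⟨ solveSeries one (λ a → a :- con (+ 1 ℚ./ 4) :* con 0ℚ := a) R.refl catalan ⟩
  catalan ∎)
  where
  open Relation.Binary.Reasoning.Setoid R.setoid
  defect : PowerSeries
  defect = catalan - (1 + X * (catalan * catalan))
  X*4defect≈0 : X * (4 * defect) ≈ 0
  X*4defect≈0 = begin
    X * (4 * defect)
      ≈⟨ solveSeries two (λ x c → x :* (con (+ 4 ℚ./ 1) :* (c :- (con 1ℚ :+ x :* (c :* c)))) :=
           (con 1ℚ :- con (+ 4 ℚ./ 1) :* x) :-
           (con 1ℚ :- con (+ 2 ℚ./ 1) :* (x :* c)) :* (con 1ℚ :- con (+ 2 ℚ./ 1) :* (x :* c)))
           R.refl X catalan ⟩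
    (1 - 4 * X) - (1 - 2 * (X * catalan)) * (1 - 2 * (X * catalan))
      ≈⟨ R.+-congˡ {1 - 4 * X} (R.-‿cong (*-cong √≈catalan √≈catalan)) ⟨
    (1 - 4 * X) - √1-4X * √1-4X
      ≈⟨ R.+-congˡ {1 - 4 * X} (R.-‿cong (√-square (1 - 4 * X) refl)) ⟩
    (1 - 4 * X) - (1 - 4 * X)
      ≈⟨ R.-‿inverseʳ (1 - 4 * X) ⟩
    0 ∎
  4defect≈0 : 4 * defect ≈ 0
  4defect≈0 n = trans (sym (X*-suc (4 * defect) n)) (trans (X*4defect≈0 (suc n)) (zero-coefficient n))
    where
    zero-coefficient : ∀ n → 0ℚ ≡ constant 0ℚ n
    zero-coefficient zero    = refl
    zero-coefficient (suc n) = refl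

geometric : PowerSeries
geometric = reciprocal (1 - X)

quadratic : PowerSeries
quadratic = 1 - 3 * X + X ^ 2

geometric-equation : geometric ≈ 1 + X * geometric
geometric-equation = begin
  geometric
    ≈⟨ solveSeries two (λ x u → u := (con 1ℚ :- x) :* u :+ x :* u) R.refl X geometric ⟩
  (1 - X) * geometric + X * geometric
    ≈⟨ R.+-congʳ {X * geometric} (*-reciprocal (1 - X)) ⟩
  1 + X * geometric ∎
  where open Relation.Binary.Reasoning.Setoid R.setoid

pivotal : PowerSeries
pivotal = (1 - X) ^ 2 * reciprocal quadratic

-- This is the recursion of P(m,k) divided by UᵐCᵏ, with the missing child on the left. Solving it
-- for p, using U = 1/(1-x), is what yields (1-x)²/(1-3x+x²).
pivotal-equation : pivotal + X ≈ X * (geometric * pivotal) + (X * pivotal + 1)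
pivotal-equation = begin
  pivotal + X
    -- The inner factor 1 keeps the place where `(1 - X) * geometric` goes in the next step; the
    -- last summand vanishes because `q` is the reciprocal of `quadratic`.
    ≈⟨ solveSeries two (λ x q → (con 1ℚ :- x) :^ two :* q :+ x :=
         x :* (con 1ℚ :* ((con 1ℚ :- x) :* q)) :+ (x :* ((con 1ℚ :- x) :^ two :* q) :+ con 1ℚ)
         :+ (con 1ℚ :- x) :* ((con 1ℚ :- con (+ 3 ℚ./ 1) :* x :+ x :^ two) :* q :- con 1ℚ))
         R.refl X q ⟩
  X * (1 * ((1 - X) * q)) + (X * pivotal + 1) + (1 - X) * (quadratic * q - 1)
    ≈⟨ R.+-cong
         (R.+-congʳ {X * pivotal + 1} (R.*-congˡ {X} (R.*-congʳ {(1 - X) * q} (R.sym (*-reciprocal (1 - X))))))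
         (R.*-congˡ {1 - X} (R.+-congʳ (*-reciprocal quadratic))) ⟩
  X * ((1 - X) * geometric * ((1 - X) * q)) + (X * pivotal + 1) + (1 - X) * (1 - 1)
    ≈⟨ solveSeries three (λ x u q → x :* ((con 1ℚ :- x) :* u :* ((con 1ℚ :- x) :* q))
            :+ (x :* ((con 1ℚ :- x) :^ two :* q) :+ con 1ℚ) :+ (con 1ℚ :- x) :* (con 1ℚ :- con 1ℚ) :=
         x :* (u :* ((con 1ℚ :- x) :^ two :* q)) :+ (x :* ((con 1ℚ :- x) :^ two :* q) :+ con 1ℚ))
         R.refl X geometric q ⟩
  X * (geometric * pivotal) + (X * pivotal + 1) ∎
  where
  open Relation.Binary.Reasoning.Setoid R.setoid
  q : PowerSeries
  q = reciprocal quadratic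

catalan-* : ∀ a → catalan * a ≈ a + X * (catalan * (catalan * a))
catalan-* a = R.trans (R.*-congʳ {a} catalan-equation)
  (solveSeries three (λ x c a → (con 1ℚ :+ x :* (c :* c)) :* a := a :+ x :* (c :* (c :* a))) R.refl X catalan a)

geometric-* : ∀ a → geometric * a ≈ a + X * (geometric * a)
geometric-* a = R.trans (R.*-congʳ {a} geometric-equation)
  (solveSeries three (λ x u a → (con 1ℚ :+ x :* u) :* a := a :+ x :* (u :* a)) R.refl X geometric a)

coefficient-suc : ∀ {a b c} → a ≈ b + X * c → ∀ d → a (suc d) ≡ b (suc d) ℚ.+ c d
coefficient-suc {b = b} {c} eq d = trans (eq (suc d)) (cong (b (suc d) ℚ.+_) (X*-suc c d))

^-zero-coefficient : ∀ a → a 0 ≡ 1ℚ → ∀ k → (a ^ k) 0 ≡ 1ℚ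
^-zero-coefficient a a₀≡1 zero    = refl
^-zero-coefficient a a₀≡1 (suc k) =
  trans (ℚ.+-identityʳ _) (cong₂ ℚ._*_ a₀≡1 (^-zero-coefficient a a₀≡1 k))

eWeight pWeight : ℕ → ℕ → PowerSeries
eWeight m k = geometric ^ m * catalan ^ k
pWeight m k = pivotal * eWeight m k

δWeight : ℕ → PowerSeries
δWeight n = (1 - pivotal) * geometric + pivotal * catalan ^ suc n

eWeight-zero : ∀ m k → eWeight m k 0 ≡ 1ℚ
eWeight-zero m k = trans (ℚ.+-identityʳ _)
  (cong₂ ℚ._*_ (^-zero-coefficient geometric refl m) (^-zero-coefficient catalan refl k))

pWeight-zero : ∀ m k → pWeight m k 0 ≡ 1ℚ
pWeight-zero m k = trans (ℚ.+-identityʳ _) (cong (pivotal 0 ℚ.*_) (eWeight-zero m k))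

δWeight-zero : ∀ n → δWeight n 0 ≡ 1ℚ
δWeight-zero n = cong (λ z → ((1 - pivotal) * geometric) 0 ℚ.+ (pivotal 0 ℚ.* z ℚ.+ 0ℚ))
  (^-zero-coefficient catalan refl (suc n))

-- Since C·Cᵏ = Cᵏ + x Cᵏ⁺², each further factor C adds the single term Cᵏ⁺².
catalan^-suc : ∀ k d → (catalan ^ k) (suc d) ≡ sumBelow k (λ i → (catalan ^ (2 ℕ.+ i)) d)
catalan^-suc zero    d = refl
catalan^-suc (suc k) d = trans
  (coefficient-suc {b = catalan ^ k} {catalan ^ (2 ℕ.+ k)} (catalan-* (catalan ^ k)) d)
  (trans (ℚ.+-comm ((catalan ^ k) (suc d)) ((catalan ^ (2 ℕ.+ k)) d))
         (cong ((catalan ^ (2 ℕ.+ k)) d ℚ.+_) (catalan^-suc k d)))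

sumBelow-cong : ∀ k {f g} → (∀ i → f i ≡ g i) → sumBelow k f ≡ sumBelow k g
sumBelow-cong zero    f≡g = refl
sumBelow-cong (suc k) f≡g = cong₂ ℚ._+_ (f≡g k) (sumBelow-cong k f≡g)

-- Induction on `m`: since U·a = a + x U·a, one more factor U adds a term equal to the weight
-- itself, the child E(m+1,k) of E(m+1,k).
eWeight-suc : ∀ m k d → eWeight m k (suc d) ≡
  sumBelow m (λ j → eWeight (suc j) k d) ℚ.+ sumBelow k (λ i → eWeight 0 (2 ℕ.+ i) d)
eWeight-suc zero k d = begin
  (1 * catalan ^ k) (suc d)                              ≡⟨ *-identityˡ (catalan ^ k) (suc d) ⟩
  (catalan ^ k) (suc d)                                  ≡⟨ catalan^-suc k d ⟩
  sumBelow k (λ i → (catalan ^ (2 ℕ.+ i)) d)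
    ≡⟨ sumBelow-cong k (λ i → *-identityˡ (catalan ^ (2 ℕ.+ i)) d) ⟨
  sumBelow k (λ i → eWeight 0 (2 ℕ.+ i) d)               ≡⟨ ℚ.+-identityˡ _ ⟨
  0ℚ ℚ.+ sumBelow k (λ i → eWeight 0 (2 ℕ.+ i) d)        ∎
  where open ≡-Reasoning
eWeight-suc (suc m) k d = begin
  eWeight (suc m) k (suc d)
    ≡⟨ coefficient-suc {b = eWeight m k} {eWeight (suc m) k} step d ⟩
  eWeight m k (suc d) ℚ.+ eWeight (suc m) k d
    ≡⟨ ℚ.+-comm (eWeight m k (suc d)) (eWeight (suc m) k d) ⟩
  eWeight (suc m) k d ℚ.+ eWeight m k (suc d)
    ≡⟨ cong (eWeight (suc m) k d ℚ.+_) (eWeight-suc m k d) ⟩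
  eWeight (suc m) k d ℚ.+
  (sumBelow m (λ j → eWeight (suc j) k d) ℚ.+ sumBelow k (λ i → eWeight 0 (2 ℕ.+ i) d))
    ≡⟨ ℚ.+-assoc (eWeight (suc m) k d) _ _ ⟨
  sumBelow (suc m) (λ j → eWeight (suc j) k d) ℚ.+ sumBelow k (λ i → eWeight 0 (2 ℕ.+ i) d) ∎
  where
  open ≡-Reasoning
  step : eWeight (suc m) k ≈ eWeight m k + X * eWeight (suc m) k
  step = R.trans (*-assoc geometric (geometric ^ m) (catalan ^ k))
    (R.trans (geometric-* (eWeight m k))
      (R.+-congˡ {eWeight m k} (R.*-congˡ {X} (R.sym (*-assoc geometric (geometric ^ m) (catalan ^ k))))))

pWeight-suc : ∀ m k d → pWeight m k (suc d) ℚ.+ eWeight m k d ≡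
  pWeight (suc m) k d ℚ.+ (pWeight m k d ℚ.+ eWeight m k (suc d))
pWeight-suc m k d = begin
  pWeight m k (suc d) ℚ.+ eWeight m k d
    ≡⟨ cong (pWeight m k (suc d) ℚ.+_) (X*-suc (eWeight m k) d) ⟨
  (pWeight m k + X * eWeight m k) (suc d)
    ≡⟨ equation (suc d) ⟩
  (X * pWeight (suc m) k + (X * pWeight m k + eWeight m k)) (suc d)
    ≡⟨ cong₂ ℚ._+_ (X*-suc (pWeight (suc m) k) d)
                   (cong (ℚ._+ eWeight m k (suc d)) (X*-suc (pWeight m k) d)) ⟩
  pWeight (suc m) k d ℚ.+ (pWeight m k d ℚ.+ eWeight m k (suc d)) ∎
  where
  open ≡-Reasoning
  equation : pWeight m k + X * eWeight m k ≈ X * pWeight (suc m) k + (X * pWeight m k + eWeight m k)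
  equation = R.trans
    (solveSeries three (λ x p b → p :* b :+ x :* b := (p :+ x) :* b) R.refl X pivotal (eWeight m k))
    (R.trans (R.*-congʳ {eWeight m k} pivotal-equation)
    (solveSeries five (λ x u p a b → (x :* (u :* p) :+ (x :* p :+ con 1ℚ)) :* (a :* b) :=
        x :* (p :* (u :* a :* b)) :+ (x :* (p :* (a :* b)) :+ a :* b)) R.refl
      X geometric pivotal (geometric ^ m) (catalan ^ k)))

-- In the step from n to n + 1 the summand (1-p)U cancels, and p Cⁿ⁺¹ satisfies what is left by C =
-- 1 + x C². The case n = 0, with δ(1) as only child, is what determines (1-p)U.
δWeight-suc : ∀ n d →
              δWeight n (suc d) ≡ δWeight (suc n) d ℚ.+ sumBelow n (λ i → pWeight 0 (2 ℕ.+ i) d)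
δWeight-suc zero d = trans (coefficient-suc {b = 1} {δWeight 1} equation d)
  (trans (ℚ.+-identityˡ (δWeight 1 d)) (sym (ℚ.+-identityʳ (δWeight 1 d))))
  where
  equation : δWeight 0 ≈ 1 + X * δWeight 1
  equation = R.trans
    (R.+-cong (R.*-congˡ {1 - pivotal} geometric-equation) (R.*-congˡ {pivotal} (catalan-* 1)))
    (solveSeries four (λ x u p c →
        (con 1ℚ :- p) :* (con 1ℚ :+ x :* u) :+ p :* (con 1ℚ :+ x :* (c :* (c :* con 1ℚ))) :=
        con 1ℚ :+ x :* ((con 1ℚ :- p) :* u :+ p :* (c :* (c :* con 1ℚ))))
      R.refl X geometric pivotal catalan)
δWeight-suc (suc n) d = begin
  δWeight (suc n) (suc d)
    ≡⟨ coefficient-suc {b = δWeight n} {pivotal * catalan ^ (3 ℕ.+ n)} equation d ⟩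
  δWeight n (suc d) ℚ.+ (pivotal * catalan ^ (3 ℕ.+ n)) d
    ≡⟨ cong (ℚ._+ (pivotal * catalan ^ (3 ℕ.+ n)) d) (δWeight-suc n d) ⟩
  -- The term `z`, so far part of δ(n+1), becomes the new child P(0,n+2), and `t` completes δ(n+2).
  y ℚ.+ z ℚ.+ s ℚ.+ t
    ≡⟨ rearrange y z s t ⟩
  y ℚ.+ t ℚ.+ (z ℚ.+ s)
    ≡⟨ cong (λ v → y ℚ.+ t ℚ.+ (v ℚ.+ s))
         (*-cong {pivotal} (λ _ → refl) (R.sym (*-identityˡ (catalan ^ (2 ℕ.+ n)))) d) ⟩
  δWeight (suc (suc n)) d ℚ.+ sumBelow (suc n) (λ i → pWeight 0 (2 ℕ.+ i) d) ∎
  where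
  open ≡-Reasoning
  y z s t : ℚ
  y = ((1 - pivotal) * geometric) d
  z = (pivotal * catalan ^ (2 ℕ.+ n)) d
  s = sumBelow n (λ i → pWeight 0 (2 ℕ.+ i) d)
  t = (pivotal * catalan ^ (3 ℕ.+ n)) d
  equation : δWeight (suc n) ≈ δWeight n + X * (pivotal * catalan ^ (3 ℕ.+ n))
  equation = R.trans
    (R.+-congˡ {(1 - pivotal) * geometric} (R.*-congˡ {pivotal} (catalan-* (catalan ^ suc n))))
    (solveSeries five (λ x y p c a →
        y :+ p :* (a :+ x :* (c :* (c :* a))) := y :+ p :* a :+ x :* (p :* (c :* (c :* a))))
      R.refl X ((1 - pivotal) * geometric) pivotal catalan (catalan ^ suc n))

weights : Weights
weights = record
  { e = eWeight ; p = pWeight ; δ = δWeight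
  ; e-zero = eWeight-zero ; p-zero = pWeight-zero ; δ-zero = δWeight-zero
  ; e-suc = eWeight-suc ; p-suc = pWeight-suc ; δ-suc = δWeight-suc
  }

-- The closed form

≈-quotient : ∀ a b c → .{{_ : NonZero (c 0)}} → c * a ≈ b → a ≈ b / c
≈-quotient a b c c*a≈b = begin
  a                        ≈⟨ *-identityˡ a ⟨
  1 * a                    ≈⟨ R.*-congʳ {a} (*-reciprocal c) ⟨
  c * reciprocal c * a     ≈⟨ solveSeries three (λ a c r → c :* r :* a := c :* a :* r) R.refl a c (reciprocal c) ⟩
  c * a * reciprocal c     ≈⟨ R.*-congʳ {reciprocal c} c*a≈b ⟩
  b * reciprocal c         ∎
  where open Relation.Binary.Reasoning.Setoid R.setoid

numerator √-factor denominator : PowerSeries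
numerator   = 1 - 4 * X + 5 * X ^ 2 - X ^ 3
√-factor    = 1 - 4 * X + 3 * X ^ 2 - X ^ 3
denominator = (1 - X) * quadratic * (1 - 2 * X + √1-4X)

quadratic-δWeight-zero : (1 - X) * quadratic * δWeight 0 ≈ quadratic - (1 - X) ^ 2 + (1 - X) ^ 3 * catalan
quadratic-δWeight-zero = begin
  (1 - X) * quadratic * δWeight 0
    ≈⟨ solveSeries five (λ y Q u q c →
         y :* Q :* ((con 1ℚ :- y :^ two :* q) :* u :+ y :^ two :* q :* (c :* con 1ℚ)) :=
         (Q :- y :^ two :* (Q :* q)) :* (y :* u) :+ y :^ three :* (Q :* q) :* c)
         R.refl (1 - X) quadratic geometric (reciprocal quadratic) catalan ⟩
  (quadratic - (1 - X) ^ 2 * (quadratic * reciprocal quadratic)) * ((1 - X) * geometric)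
    + (1 - X) ^ 3 * (quadratic * reciprocal quadratic) * catalan
    ≈⟨ R.+-cong
         (R.*-cong
           (R.+-congˡ {quadratic} (R.-‿cong (R.*-congˡ {(1 - X) ^ 2} (*-reciprocal quadratic))))
           (*-reciprocal (1 - X)))
         (R.*-congʳ {catalan} (R.*-congˡ {(1 - X) ^ 3} (*-reciprocal quadratic))) ⟩
  (quadratic - (1 - X) ^ 2 * 1) * 1 + (1 - X) ^ 3 * 1 * catalan
    ≈⟨ solveSeries three (λ y Q c →
         (Q :- y :^ two :* con 1ℚ) :* con 1ℚ :+ y :^ three :* con 1ℚ :* c :=
         Q :- y :^ two :+ y :^ three :* c)
         R.refl (1 - X) quadratic catalan ⟩
  quadratic - (1 - X) ^ 2 + (1 - X) ^ 3 * catalan ∎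
  where open Relation.Binary.Reasoning.Setoid R.setoid

-- With 1 - 2xC for the square root, both sides are polynomials in x and C that agree modulo the
-- equation of C. The multiplier 2(1-x)³ is read off from the terms in C², whose coefficient on the
-- left is -2x(1-x)³.
catalan-identity :
  (quadratic - (1 - X) ^ 2 + (1 - X) ^ 3 * catalan) * (1 - 2 * X + (1 - 2 * (X * catalan))) ≈
  numerator + √-factor * (1 - 2 * (X * catalan)) +
  2 * (1 - X) ^ 3 * (catalan - (1 + X * (catalan * catalan)))
catalan-identity = solveSeries two (λ x c →
  let Q = con 1ℚ :- con (+ 3 ℚ./ 1) :* x :+ x :^ two
      y = con 1ℚ :- x
      s = con 1ℚ :- con (+ 2 ℚ./ 1) :* (x :* c)
  in
  (Q :- y :^ two :+ y :^ three :* c) :* (con 1ℚ :- con (+ 2 ℚ./ 1) :* x :+ s) :=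
  con 1ℚ :- con (+ 4 ℚ./ 1) :* x :+ con (+ 5 ℚ./ 1) :* x :^ two :- x :^ three
    :+ (con 1ℚ :- con (+ 4 ℚ./ 1) :* x :+ con (+ 3 ℚ./ 1) :* x :^ two :- x :^ three) :* s
    :+ con (+ 2 ℚ./ 1) :* y :^ three :* (c :- (con 1ℚ :+ x :* (c :* c))))
  R.refl X catalan

denominator-δWeight-zero : denominator * δWeight 0 ≈ numerator + √-factor * √1-4X
denominator-δWeight-zero = begin
  denominator * δWeight 0
    ≈⟨ solveSeries three (λ a s d → a :* s :* d := a :* d :* s) R.refl
         ((1 - X) * quadratic) (1 - 2 * X + √1-4X) (δWeight 0) ⟩
  (1 - X) * quadratic * δWeight 0 * (1 - 2 * X + √1-4X)
    ≈⟨ *-cong quadratic-δWeight-zero (R.+-congˡ {1 - 2 * X} √≈catalan) ⟩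
  (quadratic - (1 - X) ^ 2 + (1 - X) ^ 3 * catalan) * (1 - 2 * X + (1 - 2 * (X * catalan)))
    ≈⟨ catalan-identity ⟩
  numerator + √-factor * (1 - 2 * (X * catalan)) +
  2 * (1 - X) ^ 3 * (catalan - (1 + X * (catalan * catalan)))
    ≈⟨ R.+-cong
         (R.+-congˡ {numerator} (R.*-congˡ {√-factor} (R.sym √≈catalan)))
         (R.*-congˡ {2 * (1 - X) ^ 3} (R.trans
           (R.+-congˡ {catalan} (R.-‿cong (R.sym catalan-equation))) (R.-‿inverseʳ catalan))) ⟩
  numerator + √-factor * √1-4X + 2 * (1 - X) ^ 3 * 0
    ≈⟨ R.trans (R.+-congˡ {numerator + √-factor * √1-4X} (R.zeroʳ (2 * (1 - X) ^ 3)))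
               (R.+-identityʳ (numerator + √-factor * √1-4X)) ⟩
  numerator + √-factor * √1-4X ∎
  where open Relation.Binary.Reasoning.Setoid R.setoid

empty-descending : Descending []
empty-descending = record
  { alive     = λ { _ (_ ∷ _ , () , _) }
  ; no-ascent = λ { (_ ∷ _ , () , _) }
  }

F≈δWeight : F T ≈ δWeight 0
F≈δWeight n = trans (length-S≡extensions n) (extensions-descending weights n [] empty-descending)

theorem13 :
    let T : List (Vec ℕ 4)
        T = (1 ∷ 4 ∷ 2 ∷ 3 ∷ []) ∷ (2 ∷ 3 ∷ 1 ∷ 4 ∷ []) ∷ (2 ∷ 3 ∷ 4 ∷ 1 ∷ []) ∷ []
    in  F T ≈
        (1 - 4 * X + 5 * X ^ 2 - X ^ 3 + (1 - 4 * X + 3 * X ^ 2 - X ^ 3) * √ (1 - 4 * X))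
        / ((1 - X) * (1 - 3 * X + X ^ 2) * (1 - 2 * X + √ (1 - 4 * X)))
theorem13 n = trans (cong (λ t → F t n) T-unfolded) (trans (F≈δWeight n) (δWeight≈quotient n))
  where
  -- Compared as lists: comparing the two coefficients would unfold the enumeration of S n T.
  T-unfolded : _ ≡ T
  T-unfolded = refl
  δWeight≈quotient : δWeight 0 ≈
    (1 - 4 * X + 5 * X ^ 2 - X ^ 3 + (1 - 4 * X + 3 * X ^ 2 - X ^ 3) * √ (1 - 4 * X))
    / ((1 - X) * (1 - 3 * X + X ^ 2) * (1 - 2 * X + √ (1 - 4 * X)))
  δWeight≈quotient = ≈-quotient (δWeight 0) (numerator + √-factor * √1-4X) denominator denominator-δWeight-zero
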